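{- For every graph $G$ and every odd integer $d\geq 3$, $$\pi(G^{(d)}) \leq \pi(G)^{2/(d-1)} +4.$$
   Context: All graphs are finite, simple and undirected. A path in a graph is a sequence of pairwise distinct vertices, consecutive ones adjacent. Given a vertex colouring $\phi$, a sequence $(v_1,\dots,v_{2s})$ is repetitively coloured if $\phi(v_i)=\phi(v_{s+i})$ for all $i\in\{1,\dots,s\}$; a colouring is nonrepetitive if no path is repetitively coloured. $\pi(G)$ is the minimum number of colours in a nonrepetitive colouring of $G$. For an integer $d\ge 0$, $G^{(d)}$ denotes the $d$-subdivision of $G$: each edge $vw$ is replaced by a path from $v$ to $w$ with exactly $d$ internal vertices, these paths being internally disjoint. -}

module Defs where

open import Data.Nat using (ℕ; zero; suc; _+_; _*_; _∸_; _^_; _≤_; _<_)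
open import Data.Nat.DivMod using (_/_)
open import Data.Fin as Fin using (Fin; toℕ)
open import Data.List using (List; []; _∷_; length; map; lookup; _++_)
open import Data.List.Relation.Unary.All using (All)
open import Data.List.Relation.Unary.Unique.Propositional using (Unique)
open import Data.List.Relation.Unary.Linked using (Linked)
open import Data.List.Membership.Propositional using (_∈_)
open import Data.Product using (Σ; _×_; _,_; proj₁; proj₂; ∃; ∃-syntax)
open import Data.Sum using (_⊎_; inj₁; inj₂)
open import Relation.Nullary using (¬_)
open import Relation.Binary.PropositionalEquality using (_≡_)

record Graph : Set where
  field
    n       : ℕ
    edges   : List (Fin n × Fin n)
    ordered : All (λ e → proj₁ e Fin.< proj₂ e) edges
    unique  : Unique edges

record AdjStr : Set₁ where
  field
    V   : Set
    Adj : V → V → Set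

open AdjStr public

toAdj : Graph → AdjStr
toAdj G = record
  { V   = Fin (Graph.n G)
  ; Adj = λ u v → ((u , v) ∈ Graph.edges G) ⊎ ((v , u) ∈ Graph.edges G)
  }

IsPath : (H : AdjStr) → List (V H) → Set
IsPath H xs = Unique xs × Linked (Adj H) xs

Repetitive : {A C : Set} → (A → C) → List A → Set
Repetitive {A} φ xs =
  Σ (List A) λ ys → Σ (List A) λ zs →
    (xs ≡ ys ++ zs) × (1 ≤ length ys) × (length ys ≡ length zs) × (map φ ys ≡ map φ zs)

Nonrepetitive : (H : AdjStr) (k : ℕ) → (V H → Fin k) → Set
Nonrepetitive H k φ = (xs : List (V H)) → IsPath H xs → ¬ Repetitive φ xs

IsPi : AdjStr → ℕ → Set
IsPi H k =
  (Σ (V H → Fin k) (Nonrepetitive H k)) ×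
  ((j : ℕ) (ψ : V H → Fin j) → Nonrepetitive H j ψ → k ≤ j)

-- d-subdivision.  Vertices: original vertices, plus for the i-th edge (u , v)
-- internal vertices (i , 0), ..., (i , d-1) forming the path u, (i,0), ..., (i,d-1), v.
module _ (G : Graph) (d : ℕ) where
  private
    m = length (Graph.edges G)
    src tgt : Fin m → Fin (Graph.n G)
    src i = proj₁ (lookup (Graph.edges G) i)
    tgt i = proj₂ (lookup (Graph.edges G) i)

  SubV : Set
  SubV = Fin (Graph.n G) ⊎ (Fin m × Fin d)

  data SubArc : SubV → SubV → Set where
    direct : d ≡ 0 → (i : Fin m) → SubArc (inj₁ (src i)) (inj₁ (tgt i))
    first  : (i : Fin m) (j : Fin d) → toℕ j ≡ 0 → SubArc (inj₁ (src i)) (inj₂ (i , j))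
    mid    : (i : Fin m) (j k : Fin d) → suc (toℕ j) ≡ toℕ k → SubArc (inj₂ (i , j)) (inj₂ (i , k))
    last   : (i : Fin m) (j : Fin d) → suc (toℕ j) ≡ d → SubArc (inj₂ (i , j)) (inj₁ (tgt i))

  subdivision : AdjStr
  subdivision = record { V = SubV ; Adj = λ x y → SubArc x y ⊎ SubArc y x }

{-# OPTIONS --safe #-}
module Submission where

open import Defs
open import Algebra.Properties.CommutativeSemigroup using (x∙yz≈y∙xz)
open import Data.Empty using (⊥; ⊥-elim)
open import Data.Fin using (Fin; zero; suc; toℕ; fromℕ<; inject≤)
open import Data.Fin.Permutation.Components using (transpose; transpose-inverse)
import Data.Fin.Properties as Fin
open import Data.List using (List; []; _∷_; _++_; _∷ʳ_; length; map; reverse; lookup; tabulate; head; take; drop; filter; upTo; applyUpTo; applyDownFrom; allFin; cartesianProductWith; mapMaybe; initLast; _∷ʳ′_)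
import Data.List as List
open import Data.List.Membership.Propositional using (_∈_; find; lose)
open import Data.List.Membership.Propositional.Properties
open import Data.List.Properties
open import Data.List.Relation.Binary.Permutation.Propositional using (↭-sym)
open import Data.List.Relation.Binary.Permutation.Propositional.Properties using (↭-reverse; All-resp-↭)
open import Data.List.Relation.Unary.All as All using (All; []; _∷_)
import Data.List.Relation.Unary.All.Properties as All
open import Data.List.Relation.Unary.AllPairs using ([]; _∷_)
open import Data.List.Relation.Unary.Any using (Any; here; there; any?)
open import Data.List.Relation.Unary.Linked using (Linked; []; [-]; _∷_)
open import Data.List.Relation.Unary.Unique.Propositional using (Unique)
import Data.List.Relation.Unary.Unique.Propositional.Properties as Unique
open import Data.Maybe using (just; maybe′)
import Data.Maybe.Properties as Maybe
open import Data.Nat using (ℕ; zero; suc; _+_; _*_; _∸_; _^_; _≤_; _<_; z≤n; s≤s; _<?_)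
open import Data.Nat.DivMod using (_/_; m*n/n≡m)
import Data.Nat.Properties as ℕ
open import Data.Nat.Solver using (module +-*-Solver)
open import Data.Product using (Σ; ∃; ∃₂; ∃-syntax; _×_; _,_; proj₁; proj₂)
open import Data.Sum using (_⊎_; inj₁; inj₂; isInj₁)
import Data.Sum as Sum
open import Relation.Binary using (tri<; tri≈; tri>)
open import Relation.Binary.PropositionalEquality
open import Relation.Nullary using (Dec; yes; no; ¬_; ¬?)
open import Relation.Nullary.Decidable using (dec-true; dec-false)
open import Relation.Unary using (Decidable)

-- With t = (d − 1)/2 and N = q − 4, suppose π(G) < N ^ t.  We colour the subdivision with N + 3
-- colours: 0 (on all original vertices) and K = N + 2 letters.  By Rosenfeld's counting argument
-- there are at least N ^ t squarefree words of length t over K letters with distinct first and last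
-- letter (t ≥ 2), so the colours x of a nonrepetitive colouring of G get distinct such words h x.
-- An edge between colours x and y is coloured h x, 0, reverse (h y), unless x and y are "twins",
-- h x = reverse (h y), when it gets a squarefree word of length d without 0, from the first letter
-- of h x to that of h y.  Cutting a square at its zeros, either both halves run through original
-- vertices of the same colours, which is impossible in G, or the first letters, the words h or the
-- distances between zeros conflict.  For t = 1 all pairs of distinct colours count as twins.

-- An edge must carry the same colours whichever end it is entered from, hence the reversal of
-- `h y`. For twins this would give `h x`, 0, `h x`, which is a square once preceded by the 0 of the
-- end vertex: this is the obstacle that the longer words remove. Having length 2t + 1 and no 0,
-- they cannot be mistaken for words of length t. Distinct first and last letters deal with squares
-- that have one 0 in each half. Every word leaving an original vertex coloured x begins with
-- `hd x`, and every word arriving there ends with it; if the square extends past such a vertex,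
-- that letter turns up at the wrong end of the word between the two zeros. With more zeros a whole
-- word between zeros is repeated. The words `h` identify colours, whereas a long word only reveals
-- the first letters belonging to its two ends. Of the N + 2 letters, two pay for the extensions
-- lost to squares, so that squarefree words multiply by at least N per letter; the geometric series
-- behind this needs N at least 2. The values q ≤ 5 are therefore treated directly.

private variable
  A B : Set
  k : ℕ

-- Squarefree words and words cut at separators

Squarefree : List A → Set
Squarefree w = ∀ l u r → w ≡ l ++ u ++ u ++ r → u ≡ []

++-length-cancelˡ : (a b : List A) {c d : List A} → length a ≡ length b → a ++ c ≡ b ++ d → a ≡ b × c ≡ d
++-length-cancelˡ []      []      _ e = refl , e
++-length-cancelˡ (x ∷ a) (y ∷ b) l e with refl , e′ ← ∷-injective e
  with refl , q ← ++-length-cancelˡ a b (ℕ.suc-injective l) e′ = refl , q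

map-++⁻ : (f : A → B) (w : List A) (a : List B) {b : List B} → map f w ≡ a ++ b →
          ∃₂ λ u v → w ≡ u ++ v × a ≡ map f u × b ≡ map f v
map-++⁻ f w       []      e = [] , w , refl , refl , sym e
map-++⁻ f (x ∷ w) (y ∷ a) e with refl , e′ ← ∷-injective e
  with u , v , refl , refl , refl ← map-++⁻ f w a e′ = x ∷ u , v , refl , refl , refl

snoc≢[] : (l : List A) {x : A} → l ∷ʳ x ≢ []
snoc≢[] []      ()
snoc≢[] (_ ∷ _) ()

reverse-snoc : (l : List A) (x : A) → reverse (l ∷ʳ x) ≡ x ∷ reverse l
reverse-snoc l x = reverse-++ l (x ∷ [])

reverse≡⇒≡reverse : {a b : List A} → reverse a ≡ b → a ≡ reverse b
reverse≡⇒≡reverse {a = a} e = trans (sym (reverse-involutive a)) (cong reverse e)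

reverse-++³ : (l u r : List A) → reverse (l ++ u ++ u ++ r) ≡ reverse r ++ reverse u ++ reverse u ++ reverse l
reverse-++³ l u r = begin
  reverse (l ++ u ++ u ++ r)                               ≡⟨ reverse-++ l _ ⟩
  reverse (u ++ u ++ r) ++ reverse l                       ≡⟨ cong (_++ reverse l) (reverse-++ u _) ⟩
  (reverse (u ++ r) ++ reverse u) ++ reverse l             ≡⟨ ++-assoc (reverse (u ++ r)) _ _ ⟩
  reverse (u ++ r) ++ reverse u ++ reverse l               ≡⟨ cong (_++ reverse u ++ reverse l) (reverse-++ u r) ⟩
  (reverse r ++ reverse u) ++ reverse u ++ reverse l       ≡⟨ ++-assoc (reverse r) _ _ ⟩
  reverse r ++ reverse u ++ reverse u ++ reverse l         ∎
  where open ≡-Reasoning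

squarefree-reverse : {w : List A} → Squarefree w → Squarefree (reverse w)
squarefree-reverse {w = w} sf l u r e =
  reverse-injective (sf (reverse r) (reverse u) (reverse l)
    (trans (reverse≡⇒≡reverse e) (reverse-++³ l u r)))

squarefree-factor : (l : List A) {w : List A} (r : List A) → Squarefree (l ++ w ++ r) → Squarefree w
squarefree-factor l {w} r sf l′ u r′ refl = sf (l ++ l′) u (r′ ++ r) (begin
  l ++ (l′ ++ u ++ u ++ r′) ++ r  ≡⟨ cong (l ++_) (++-assoc l′ _ r) ⟩
  l ++ l′ ++ (u ++ u ++ r′) ++ r  ≡⟨ cong (λ z → l ++ l′ ++ z) (++-assoc u _ r) ⟩
  l ++ l′ ++ u ++ (u ++ r′) ++ r  ≡⟨ cong (λ z → l ++ l′ ++ u ++ z) (++-assoc u _ r) ⟩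
  l ++ l′ ++ u ++ u ++ r′ ++ r    ≡⟨ ++-assoc l l′ _ ⟨
  (l ++ l′) ++ u ++ u ++ r′ ++ r  ∎)
  where open ≡-Reasoning

squarefree-map : (f : A → B) → (∀ {x y} → f x ≡ f y → x ≡ y) → {w : List A} →
                 Squarefree w → Squarefree (map f w)
squarefree-map f inj {w} sf l u r e
  with l′ , v , refl , refl , e₁ ← map-++⁻ f w l e
  with u₁ , v₁ , refl , refl , e₂ ← map-++⁻ f v u (sym e₁)
  with u₂ , r′ , refl , e₃ , refl ← map-++⁻ f v₁ (map f u₁) (sym e₂)
  with refl ← map-injective inj e₃ = cong (map f) (sf l′ u₁ r′ refl)

-- With separator zero: encs (b₁ ∷ b₂ ∷ …) = 0 b₁ 0 b₂ ….
encs : List (List (Fin k)) → List (Fin (suc k))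
encs []       = []
encs (b ∷ bs) = zero ∷ map suc b ++ encs bs

encs-++ : (as bs : List (List (Fin k))) → encs (as ++ bs) ≡ encs as ++ encs bs
encs-++ []       bs = refl
encs-++ (a ∷ as) bs = cong (zero ∷_) (trans (cong (map suc a ++_) (encs-++ as bs)) (sym (++-assoc (map suc a) _ _)))

encs-injective : (a : List (Fin k)) (as : List (List (Fin k))) (b : List (Fin k)) (bs : List (List (Fin k))) →
                 map suc a ++ encs as ≡ map suc b ++ encs bs → a ≡ b × as ≡ bs
encs-injective []      []       []      []       e = refl , refl
encs-injective []      (a ∷ as) []      (b ∷ bs) e
  with refl , refl ← encs-injective a as b bs (∷-injectiveʳ e) = refl , refl
encs-injective (_ ∷ _) _        []      []       ()
encs-injective (_ ∷ _) _        []      (_ ∷ _)  ()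
encs-injective (x ∷ a) as       (y ∷ b) bs       e
  with refl ← Fin.suc-injective (∷-injectiveˡ e)
  with refl , refl ← encs-injective a as b bs (∷-injectiveʳ e) = refl , refl

encs-surjective : (X : List (Fin (suc k))) → ∃₂ λ a as → X ≡ map suc a ++ encs as
encs-surjective []            = [] , [] , refl
encs-surjective (zero  ∷ X) with a , as , refl ← encs-surjective X = [] , a ∷ as , refl
encs-surjective (suc x ∷ X) with a , as , refl ← encs-surjective X = x ∷ a , as , refl

encs-snoc-map : (as : List (List (Fin k))) (z x : List (Fin k)) → encs (as ∷ʳ z) ++ map suc x ≡ encs (as ∷ʳ (z ++ x))
encs-snoc-map as z x = begin
  encs (as ∷ʳ z) ++ map suc x                ≡⟨ cong (_++ map suc x) (encs-++ as (z ∷ [])) ⟩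
  (encs as ++ zero ∷ map suc z ++ []) ++ map suc x ≡⟨ ++-assoc (encs as) _ _ ⟩
  encs as ++ zero ∷ (map suc z ++ []) ++ map suc x ≡⟨ cong (λ q → encs as ++ zero ∷ q ++ map suc x) (++-identityʳ _) ⟩
  encs as ++ zero ∷ map suc z ++ map suc x   ≡⟨ cong (λ q → encs as ++ zero ∷ q) (map-++ suc z x) ⟨
  encs as ++ zero ∷ map suc (z ++ x)         ≡⟨ cong (λ q → encs as ++ zero ∷ q) (++-identityʳ _) ⟨
  encs as ++ encs ((z ++ x) ∷ [])            ≡⟨ encs-++ as _ ⟨
  encs (as ∷ʳ (z ++ x))                      ∎
  where open ≡-Reasoning

encs-double : (x : List (Fin k)) (ys : List (List (Fin k))) (z : List (Fin k)) →
              let X = map suc x ++ encs (ys ∷ʳ z) in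
              X ++ X ≡ map suc x ++ encs ((ys ∷ʳ (z ++ x)) ++ (ys ∷ʳ z))
encs-double x ys z = begin
  (map suc x ++ encs (ys ∷ʳ z)) ++ map suc x ++ encs (ys ∷ʳ z)  ≡⟨ ++-assoc (map suc x) _ _ ⟩
  map suc x ++ encs (ys ∷ʳ z) ++ map suc x ++ encs (ys ∷ʳ z)    ≡⟨ cong (map suc x ++_) (++-assoc (encs (ys ∷ʳ z)) _ _) ⟨
  map suc x ++ (encs (ys ∷ʳ z) ++ map suc x) ++ encs (ys ∷ʳ z)  ≡⟨ cong (λ q → map suc x ++ q ++ encs (ys ∷ʳ z)) (encs-snoc-map ys z x) ⟩
  map suc x ++ encs (ys ∷ʳ (z ++ x)) ++ encs (ys ∷ʳ z)          ≡⟨ cong (map suc x ++_) (encs-++ (ys ∷ʳ (z ++ x)) _) ⟨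
  map suc x ++ encs ((ys ∷ʳ (z ++ x)) ++ (ys ∷ʳ z))             ∎
  where open ≡-Reasoning

map-suc-double : (x : List (Fin k)) →
                 (map suc x ++ encs []) ++ (map suc x ++ encs []) ≡ map suc (x ++ x) ++ encs []
map-suc-double x = begin
  (map suc x ++ []) ++ (map suc x ++ [])  ≡⟨ cong (λ q → q ++ q) (++-identityʳ (map suc x)) ⟩
  map suc x ++ map suc x                  ≡⟨ map-++ suc x x ⟨
  map suc (x ++ x)                        ≡⟨ ++-identityʳ _ ⟨
  map suc (x ++ x) ++ []                  ∎
  where open ≡-Reasoning

-- A square containing a separator contains an even number of them, and its middle block is
-- the concatenation of the last block and the first.
encs-square : (pre : List (Fin k)) (ws : List (List (Fin k))) (post : List (Fin k)) (X : List (Fin (suc k))) →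
              map suc pre ++ encs (ws ∷ʳ post) ≡ X ++ X →
              ∃ λ ys → ws ≡ ys ++ (post ++ pre) ∷ ys
encs-square pre ws post X e with encs-surjective X
... | x , xs , refl with initLast xs
... | [] = ⊥-elim (snoc≢[] ws (proj₂ (encs-injective pre (ws ∷ʳ post) (x ++ x) []
             (trans e (map-suc-double x)))))
... | ys ∷ʳ′ z
  with refl , q ← encs-injective pre (ws ∷ʳ post) x ((ys ∷ʳ (z ++ x)) ++ (ys ∷ʳ z))
                    (trans e (encs-double x ys z))
  with r , refl ← ∷ʳ-injective ws ((ys ∷ʳ (z ++ x)) ++ ys) (trans q (sym (++-assoc (ys ∷ʳ (z ++ x)) ys (z ∷ []))))
  = ys , trans r (++-assoc ys _ ys)

join-split : (a : List (Fin k)) {b : List (Fin k)} (s : List (Fin (suc k))) {t : List (Fin (suc k))} →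
             map suc a ++ zero ∷ map suc b ≡ s ++ t →
             (∃₂ λ a₁ a₂ → a ≡ a₁ ++ a₂ × s ≡ map suc a₁ × t ≡ map suc a₂ ++ zero ∷ map suc b) ⊎
             (∃₂ λ b₁ b₂ → b ≡ b₁ ++ b₂ × s ≡ map suc a ++ zero ∷ map suc b₁ × t ≡ map suc b₂)
join-split a       []      e = inj₁ ([] , a , refl , refl , sym e)
join-split []  {b} (x ∷ s) e with refl , e′ ← ∷-injective e
  with b₁ , b₂ , refl , refl , refl ← map-++⁻ suc b s e′ = inj₂ (b₁ , b₂ , refl , refl , refl)
join-split (y ∷ a) (x ∷ s) e with refl , e′ ← ∷-injective e with join-split a s e′
... | inj₁ (a₁ , a₂ , refl , refl , q) = inj₁ (y ∷ a₁ , a₂ , refl , refl , q)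
... | inj₂ (b₁ , b₂ , p , refl , q)    = inj₂ (b₁ , b₂ , p , refl , q)

zero∉map-suc : (s : List (Fin (suc k))) {r : List (Fin (suc k))} (v : List (Fin k)) → s ++ zero ∷ r ≢ map suc v
zero∉map-suc []      []      ()
zero∉map-suc []      (_ ∷ _) ()
zero∉map-suc (_ ∷ s) []      ()
zero∉map-suc (_ ∷ s) (_ ∷ v) e = zero∉map-suc s v (∷-injectiveʳ e)

-- The single separator cannot lie in one copy of `u`, since it would then lie in the other too; so
-- a square stays on one side of it.
squarefree-join : {a b : List (Fin k)} → Squarefree a → Squarefree b →
                  Squarefree (map suc a ++ zero ∷ map suc b)
squarefree-join {a = a} sa sb l u r e with join-split a l e
... | inj₂ (b₁ , b₂ , refl , refl , q) =
  squarefree-map suc Fin.suc-injective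
    (squarefree-factor b₁ [] (subst Squarefree (cong (b₁ ++_) (sym (++-identityʳ b₂))) sb)) [] u r (sym q)
... | inj₁ (a₁ , a₂ , refl , refl , q) with join-split a₂ u (sym q)
...   | inj₂ (b₁ , b₂ , _ , refl , q′) =
  ⊥-elim (zero∉map-suc (map suc a₂) b₂ (trans (sym (++-assoc (map suc a₂) _ r)) q′))
...   | inj₁ (c₁ , c₂ , refl , refl , q′) with join-split c₂ (map suc c₁) (sym q′)
...     | inj₂ (_ , _ , _ , q″ , _) = ⊥-elim (zero∉map-suc (map suc c₂) c₁ (sym q″))
...     | inj₁ (c₃ , c₄ , refl , q″ , _) with refl ← map-injective Fin.suc-injective q″ =
  cong (map suc) (sa a₁ c₁ c₄ refl)

-- Colours of paths as words

-- Common interface for `t` equal to 1 and `t` at least 2. The two differ in `twin-code`: either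
-- first letters already identify colours, or twins have mutually reversed words, so that a colour
-- has at most one twin.
record Code (p K t : ℕ) : Set₁ where
  field
    h             : Fin p → List (Fin K)
    hd            : Fin p → Fin K
    h-head        : ∀ x → ∃ λ l → h x ≡ hd x ∷ l
    h-length      : ∀ x → length (h x) ≡ t
    h-squarefree  : ∀ x → Squarefree (h x)
    h-injective   : ∀ {x y} → h x ≡ h y → x ≡ y
    Twin          : Fin p → Fin p → Set
    twin?         : ∀ x y → Dec (Twin x y)
    twin-sym      : ∀ {x y} → Twin x y → Twin y x
    twin-heads    : ∀ {x y} → Twin x y → hd x ≢ hd y
    twin-code     : (∀ {x y} → hd x ≡ hd y → x ≡ y) ⊎ (∀ {x y} → Twin x y → h x ≡ reverse (h y))
    non-twin-ends : ∀ {x y} → x ≢ y → ¬ Twin x y → ∀ l → h x ≢ l ∷ʳ hd x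
    non-twin-code : ∀ {x y} → x ≢ y → ¬ Twin x y → h x ≢ reverse (h y)
    v             : Fin p → Fin p → List (Fin K)
    v-head        : ∀ {x y} → Twin x y → ∃ λ l → v x y ≡ hd x ∷ l
    v-reverse     : ∀ {x y} → Twin x y → v x y ≡ reverse (v y x)
    v-length      : ∀ {x y} → Twin x y → length (v x y) ≡ suc (t + t)
    v-squarefree  : ∀ {x y} → Twin x y → Squarefree (v x y)

module Walks {p K t : ℕ} (code : Code p K t) where
  open Code code

  Word : Set
  Word = List (Fin K)

  Normal : Fin p → Fin p → Set
  Normal x y = x ≢ y × ¬ Twin x y

  normal-sym : ∀ {x y} → Normal x y → Normal y x
  normal-sym (x≢y , n) = (λ e → x≢y (sym e)) , (λ s → n (twin-sym s))

  -- The vertices coloured zero on the walk: original vertices, and middle vertices of edges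
  -- between non-twins.
  data State : Set where
    orig : Fin p → State
    mid  : Fin p → Fin p → State

  data Step : State → Word → State → Set where
    out  : ∀ {x y w} → Normal x y → w ≡ h x → Step (orig x) w (mid x y)
    into : ∀ {x y w} → Normal x y → w ≡ reverse (h y) → Step (mid x y) w (orig y)
    thru : ∀ {x y w} → Twin x y → w ≡ v x y → Step (orig x) w (orig y)

  -- A path may begin and end inside an edge. What is seen before its first zero is a suffix of a
  -- word leading there, and what is seen after its last zero is a prefix of a word leading on.
  PreOk PostOk : State → Word → Set
  PreOk s pre  = pre ≡ [] ⊎ ∃₂ λ s′ m → Step s′ (m ++ pre) s
  PostOk r post = post ≡ [] ⊎ ∃₂ λ r′ m → Step r (post ++ m) r′

  length-reverse-h : ∀ x → length (reverse (h x)) ≡ t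
  length-reverse-h x = trans (length-reverse (h x)) (h-length x)

  reverse-h-last : ∀ x → ∃ λ l → reverse (h x) ≡ l ∷ʳ hd x
  reverse-h-last x with l , e ← h-head x = reverse l , trans (cong reverse e) (unfold-reverse (hd x) l)

  v-last : ∀ {x y} → Twin x y → ∃ λ l → v x y ≡ l ∷ʳ hd y
  v-last s with l , e ← v-head (twin-sym s) =
    reverse l , trans (v-reverse s) (trans (cong reverse e) (unfold-reverse _ l))

  step-first : ∀ {x w r} → Step (orig x) w r → ∃ λ l → w ≡ hd x ∷ l
  step-first (out _ refl)  = h-head _
  step-first (thru s refl) = v-head s

  step-last : ∀ {s w x} → Step s w (orig x) → ∃ λ l → w ≡ l ∷ʳ hd x
  step-last (into _ refl) = reverse-h-last _
  step-last (thru s refl) = v-last s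

  pre-orig : ∀ {x pre} → PreOk (orig x) pre → pre ≡ [] ⊎ ∃ λ l → pre ≡ l ∷ʳ hd x
  pre-orig (inj₁ e) = inj₁ e
  pre-orig {pre = pre} (inj₂ (_ , m , st)) with initLast pre
  ... | []      = inj₁ refl
  ... | l ∷ʳ′ b with l′ , e ← step-last st
    with refl ← ∷ʳ-injectiveʳ (m ++ l) l′ (trans (++-assoc m l _) e) = inj₂ (l , refl)

  post-orig : ∀ {x post} → PostOk (orig x) post → post ≡ [] ⊎ ∃ λ l → post ≡ hd x ∷ l
  post-orig (inj₁ e) = inj₁ e
  post-orig {post = []}    (inj₂ _) = inj₁ refl
  post-orig {post = b ∷ l} (inj₂ (_ , m , st)) with _ , e ← step-first st
    with refl ← ∷-injectiveˡ e = inj₂ (l , refl)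

  pre-mid : ∀ {x y pre} → PreOk (mid x y) pre → length pre ≤ t
  pre-mid (inj₁ refl) = z≤n
  pre-mid {x} {pre = pre} (inj₂ (_ , m , out _ e)) =
    subst (length pre ≤_) (trans (sym (length-++ m)) (trans (cong length e) (h-length x))) (ℕ.m≤n+m _ _)

  post-mid : ∀ {x y post} → PostOk (mid x y) post → length post ≤ t
  post-mid (inj₁ refl) = z≤n
  post-mid {y = y} {post = post} (inj₂ (_ , m , into _ e)) =
    subst (length post ≤_) (trans (sym (length-++ post)) (trans (cong length e) (length-reverse-h y))) (ℕ.m≤m+n _ _)

  h≢[] : ∀ {x} → h x ≢ []
  h≢[] {x} e with l , q ← h-head x with () ← trans (sym e) q

  reverse-h≢[] : ∀ {x} → reverse (h x) ≢ []
  reverse-h≢[] {x} e = h≢[] (reverse-injective e)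

  -- A square with one separator in each half: already the end letters rule it out.
  no-short-square : ∀ {s w r pre post} → Step s w r → w ≡ post ++ pre → PreOk s pre → PostOk r post → ⊥
  no-short-square {pre = pre} {post} (out {x} {y} n@(x≢y , ¬tw) refl) e pr po with pre-orig pr
  ... | inj₂ (l , refl) = non-twin-ends x≢y ¬tw (post ++ l) (trans e (sym (++-assoc post l _)))
  ... | inj₁ refl with po
  ...   | inj₁ refl = h≢[] e
  ...   | inj₂ (_ , m , into _ q) = non-twin-code x≢y ¬tw (begin
      h x            ≡⟨ trans e (++-identityʳ post) ⟩
      post           ≡⟨ proj₁ (++-length-cancelˡ post (reverse (h y))
                                (trans (cong length (sym (trans e (++-identityʳ post))))
                                  (trans (h-length x) (sym (length-reverse-h y))))
                                (trans q (sym (++-identityʳ _)))) ⟩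
      reverse (h y)  ∎)
    where open ≡-Reasoning
  no-short-square {pre = pre} {post} (into {y} {x} n refl) e pr po with n′@(x≢y , ¬tw) ← normal-sym n
    with post-orig po
  ... | inj₂ (l , refl) = non-twin-ends x≢y ¬tw (reverse (l ++ pre))
          (trans (reverse≡⇒≡reverse e) (unfold-reverse (hd x) (l ++ pre)))
  ... | inj₁ refl with pr
  ...   | inj₁ refl = reverse-h≢[] e
  ...   | inj₂ (_ , [] , out _ q) = non-twin-code (proj₁ n) (proj₂ n) (trans (sym q) (sym e))
  ...   | inj₂ (_ , b ∷ m , out _ q) = ℕ.<-irrefl refl (begin-strict
      t                         ≡⟨ length-reverse-h x ⟨
      length (reverse (h x))    ≡⟨ cong length e ⟩
      length pre                ≤⟨ ℕ.m≤n+m _ (length m) ⟩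
      length m + length pre     <⟨ ℕ.n<1+n _ ⟩
      suc (length m + length pre) ≡⟨ cong suc (length-++ m) ⟨
      length ((b ∷ m) ++ pre)   ≡⟨ cong length q ⟩
      length (h y)              ≡⟨ h-length y ⟩
      t                         ∎)
    where open ℕ.≤-Reasoning
  no-short-square {pre = pre} {post} (thru {x} {y} tw refl) e pr po with pre-orig pr
  ... | inj₂ (l , refl) with l′ , q ← v-last tw =
          twin-heads tw (∷ʳ-injectiveʳ (post ++ l) l′ (trans (++-assoc post l _) (trans (sym e) q)))
  ... | inj₁ refl with post-orig po | v-head tw
  ...   | inj₁ refl       | _ , q with () ← trans (sym e) q
  ...   | inj₂ (l , refl) | _ , q = twin-heads tw (∷-injectiveˡ (trans (sym q) e))

  data Walk : State → List Word → State → Set where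
    []  : ∀ {s} → Walk s [] s
    _∷_ : ∀ {s w s′ ws r} → Step s w s′ → Walk s′ ws r → Walk s (w ∷ ws) r

  colour-of : State → List (Fin p)
  colour-of (orig x)  = x ∷ []
  colour-of (mid _ _) = []

  origs : ∀ {s ws r} → Walk s ws r → List (Fin p)
  origs {s} []      = colour-of s
  origs {s} (_ ∷ W) = colour-of s ++ origs W

  walk-split : ∀ {s r} ys {v zs} (W : Walk s (ys ++ v ∷ zs) r) →
               ∃₂ λ s′ r′ → Σ (Walk s ys s′) λ W₁ → Step s′ v r′ × Σ (Walk r′ zs r) λ W₂ →
               origs W ≡ origs W₁ ++ origs W₂
  walk-split []       (st ∷ W) = _ , _ , [] , st , W , refl
  walk-split {s} (y ∷ ys) (st ∷ W) with _ , _ , W₁ , st′ , W₂ , e ← walk-split ys W =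
    _ , _ , st ∷ W₁ , st′ , W₂ , trans (cong (colour-of s ++_) e) (sym (++-assoc (colour-of s) _ _))

  -- Middle vertices of different edges are identified: `h x` does not reveal the far end of the
  -- edge, but the word after a middle vertex determines the next original colour by itself.
  data Same : State → State → Set where
    orig : ∀ {x} → Same (orig x) (orig x)
    mid  : ∀ {x y x′ y′} → Same (mid x y) (mid x′ y′)

  h≢v : ∀ {x y z} {w : Word} → Twin y z → w ≡ h x → w ≢ v y z
  h≢v {x} tw e e′ = ℕ.<-irrefl refl (begin-strict
      t            ≤⟨ ℕ.m≤m+n t t ⟩
      t + t        <⟨ ℕ.n<1+n _ ⟩
      suc (t + t)  ≡⟨ v-length tw ⟨
      length (v _ _) ≡⟨ cong length (trans (sym e′) e) ⟩
      length (h x) ≡⟨ h-length x ⟩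
      t            ∎)
    where open ℕ.≤-Reasoning

  rh≢v : ∀ {x y z} {w : Word} → Twin y z → w ≡ reverse (h x) → w ≢ v y z
  rh≢v {x} tw e e′ = h≢v (twin-sym tw) (sym (reverse≡⇒≡reverse (sym e)))
                         (trans (cong reverse e′) (sym (v-reverse (twin-sym tw))))

  -- Either twins are unique, or the last letter of `v x y`, which is `hd y`, identifies `y`.
  twin-determined : ∀ {x y y′} → Twin x y → Twin x y′ → v x y ≡ v x y′ → y ≡ y′
  twin-determined tw tw′ e with twin-code
  ... | inj₂ c = h-injective (reverse-injective (trans (sym (c tw)) (c tw′)))
  ... | inj₁ c with l , q ← v-last tw | l′ , q′ ← v-last tw′ =
        c (∷ʳ-injectiveʳ l l′ (trans (sym q) (trans e q′)))

  same-step : ∀ {s r w s′ r′} → Same s r → Step s w s′ → Step r w r′ → Same s′ r′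
  same-step orig (out _ _)   (out _ _)    = mid
  same-step orig (out _ e)   (thru s e′)  = ⊥-elim (h≢v s e e′)
  same-step orig (thru s e)  (out _ e′)   = ⊥-elim (h≢v s e′ e)
  same-step orig (thru s e)  (thru s′ e′) with refl ← twin-determined s s′ (trans (sym e) e′) = orig
  same-step mid  (into _ e)  (into _ e′) with refl ← h-injective (reverse-injective (trans (sym e) e′)) = orig

  same-colour : ∀ {s r} → Same s r → colour-of s ≡ colour-of r
  same-colour orig = refl
  same-colour mid  = refl

  same-walk : ∀ {s r ys s′ r′} → Same s r → (W : Walk s ys s′) (W′ : Walk r ys r′) → origs W ≡ origs W′
  same-walk e []       []         = same-colour e
  same-walk e (st ∷ W) (st′ ∷ W′) = cong₂ _++_ (same-colour e) (same-walk (same-step e st st′) W W′)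

  -- Walks with the same words from distinct originals only use twin edges, and if twins are
  -- unique such a walk alternates between two colours.
  twin-walk : (∀ {x y} → Twin x y → h x ≡ reverse (h y)) →
              ∀ {x z ys s r} → x ≢ z → Walk (orig x) ys s → Walk (orig z) ys r →
              ∃ λ c → s ≡ orig c × (c ≡ x ⊎ Twin x c)
  twin-walk c x≢z [] [] = _ , refl , inj₁ refl
  twin-walk c x≢z (out _ e ∷ _)  (out _ e′ ∷ _)  = ⊥-elim (x≢z (h-injective (trans (sym e) e′)))
  twin-walk c x≢z (out _ e ∷ _)  (thru s e′ ∷ _) = ⊥-elim (h≢v s e e′)
  twin-walk c x≢z (thru s e ∷ _) (out _ e′ ∷ _)  = ⊥-elim (h≢v s e′ e)
  twin-walk c {x} x≢z (thru {y = y} s e ∷ W) (thru {y = y′} s′ e′ ∷ W′)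
    with twin-walk c (λ { refl → x≢z (h-injective (trans (c s) (sym (c s′)))) }) W W′
  ... | d , refl , inj₁ refl = d , refl , inj₂ s
  ... | d , refl , inj₂ s″   = d , refl , inj₁ (h-injective (trans (c (twin-sym s″)) (sym (c s))))

  -- Both walks must start with twin edges, whose words agree in the first letter, so `hd x` equals
  -- `hd z`. If this does not yet identify `x` with `z`, the first walk ends at `x` or at its twin.
  -- The step `st` then makes `x` and `z` twins, against their equal first letters, or makes both
  -- the unique twin of one colour.
  no-distinct : ∀ {x z y ys s u r} → x ≢ z → Walk (orig x) (y ∷ ys) s → Step s u (orig z) →
                Walk (orig z) (y ∷ ys) r → ⊥
  no-distinct x≢z (out _ e ∷ _)  st (out _ e′ ∷ _)  = x≢z (h-injective (trans (sym e) e′))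
  no-distinct x≢z (out _ e ∷ _)  st (thru s e′ ∷ _) = h≢v s e e′
  no-distinct x≢z (thru s e ∷ _) st (out _ e′ ∷ _)  = h≢v s e′ e
  no-distinct {x} {z} x≢z W@(thru s e ∷ _) st W′@(thru s′ e′ ∷ _)
    with l , q ← v-head s | l′ , q′ ← v-head s′
    with hds ← ∷-injectiveˡ (trans (sym q) (trans (sym e) (trans e′ q′)))
    with twin-code
  ... | inj₁ c = x≢z (c hds)
  ... | inj₂ c with twin-walk c x≢z W W′ | st
  ...   | _ , refl , inj₁ refl | thru tw _ = twin-heads tw hds
  ...   | _ , refl , inj₂ tw   | thru tw′ _ =
          x≢z (h-injective (trans (c tw) (sym (c (twin-sym tw′)))))

  -- An original against a middle vertex: two consecutive steps would force the two ends of a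
  -- normal edge to have the same colour.
  no-misaligned : ∀ {x z z′ y ys s u r} → Walk (orig x) (y ∷ ys) s → Step s u (mid z′ z) →
                  Walk (mid z′ z) (y ∷ ys) r → ⊥
  no-misaligned (thru s e ∷ _) st (into _ e′ ∷ _) = rh≢v s e′ e
  no-misaligned (out _ _ ∷ []) () (into _ _ ∷ [])
  no-misaligned (out _ e ∷ into _ e₂ ∷ _) st (into _ e′ ∷ thru s e₂′ ∷ _) = rh≢v s e₂ e₂′
  no-misaligned (out (x≢ , _) e ∷ into _ e₂ ∷ _) st (into _ e′ ∷ out _ e₂′ ∷ _) =
    x≢ (h-injective (trans (sym e) (trans e′ (trans (cong reverse (trans (sym e₂′) e₂)) (reverse-involutive _)))))

  -- With two or more steps the argument is the same with the roles exchanged. With one step, `u` is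
  -- the word of a twin edge, of length 2t + 1; but it is composed of `post` and `pre`, each
  -- bordering a middle vertex and hence of length at most t.
  no-misaligned′ : ∀ {x z z′ y ys s u r pre post} → Walk (mid z′ z) (y ∷ ys) s → Step s u (orig x) →
                   Walk (orig x) (y ∷ ys) r → u ≡ post ++ pre → PreOk (mid z′ z) pre → PostOk r post → ⊥
  no-misaligned′ (into _ e ∷ _) st (thru s e′ ∷ _) _ _ _ = rh≢v s e e′
  no-misaligned′ {pre = pre} {post} (into _ _ ∷ []) (thru tw e) (out _ _ ∷ []) q pr po =
    ℕ.<-irrefl refl (begin-strict
      t + t                    <⟨ ℕ.n<1+n _ ⟩
      suc (t + t)              ≡⟨ v-length tw ⟨
      length (v _ _)           ≡⟨ cong length (trans (sym e) q) ⟩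
      length (post ++ pre)     ≡⟨ length-++ post ⟩
      length post + length pre ≤⟨ ℕ.+-mono-≤ (post-mid po) (pre-mid pr) ⟩
      t + t                    ∎)
    where open ℕ.≤-Reasoning
  no-misaligned′ (into _ e ∷ thru s e₂ ∷ _) st (out _ e′ ∷ into _ e₂′ ∷ _) _ _ _ = rh≢v s e₂′ e₂
  no-misaligned′ (into _ e ∷ out _ e₂ ∷ _) st (out (x≢ , _) e′ ∷ into _ e₂′ ∷ _) _ _ _ =
    x≢ (h-injective (trans (sym e′) (trans e (trans (cong reverse (trans (sym e₂) e₂′)) (reverse-involutive _)))))

  origs≢[] : ∀ {s y ys r} (W : Walk s (y ∷ ys) r) → origs W ≢ []
  origs≢[] (out _ _ ∷ _)        ()
  origs≢[] (thru _ _ ∷ _)       ()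
  origs≢[] (into _ _ ∷ [])      ()
  origs≢[] (into _ _ ∷ (_ ∷ _)) ()

  -- The centre of the square cuts the word `post ++ pre`, and the walks before and after it have
  -- the same words `ys`. If they start alike, their original vertices have the same colours and
  -- `origs W` is a square; every other pair of starting states has been excluded.
  no-square : ∀ {s ws r pre post X} (W : Walk s ws r) → PreOk s pre → PostOk r post →
              Squarefree (origs W) → map suc pre ++ encs (ws ∷ʳ post) ≢ X ++ X
  no-square {ws = ws} {pre = pre} {post} {X} W pr po sf e with encs-square pre ws post X e
  ... | ys , refl with walk-split ys W
  ... | s′ , r′ , W₁ , st , W₂ , q = go ys W₁ st W₂ q
    where
    repeated : ∀ {y ys s s′ r r′} (W₁ : Walk s (y ∷ ys) s′) (W₂ : Walk r (y ∷ ys) r′) → Same s r →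
               origs W ≡ origs W₁ ++ origs W₂ → ⊥
    repeated W₁ W₂ same q = origs≢[] W₁ (sf [] (origs W₁) [] (trans q
      (cong (origs W₁ ++_) (trans (sym (same-walk same W₁ W₂)) (sym (++-identityʳ _))))))
    go : ∀ ys {s′ r′} (W₁ : Walk _ ys s′) → Step s′ (post ++ pre) r′ → (W₂ : Walk r′ ys _) →
         origs W ≡ origs W₁ ++ origs W₂ → ⊥
    go [] [] st [] q = no-short-square st refl pr po
    go (_ ∷ _) {_} {orig z} W₁@(out {x} _ _ ∷ _)  st W₂ q with x Fin.≟ z
    ... | yes refl = repeated W₁ W₂ orig q
    ... | no x≢z   = no-distinct x≢z W₁ st W₂
    go (_ ∷ _) {_} {orig z} W₁@(thru {x} _ _ ∷ _) st W₂ q with x Fin.≟ z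
    ... | yes refl = repeated W₁ W₂ orig q
    ... | no x≢z   = no-distinct x≢z W₁ st W₂
    go (_ ∷ _) {_} {mid _ _} W₁@(out _ _ ∷ _)  st W₂ q = no-misaligned W₁ st W₂
    go (_ ∷ _) {_} {mid _ _} W₁@(thru _ _ ∷ _) st W₂ q = no-misaligned W₁ st W₂
    go (_ ∷ _) {_} {mid _ _} W₁@(into _ _ ∷ _) st W₂ q = repeated W₁ W₂ mid q
    go (_ ∷ _) {_} {orig _}  W₁@(into _ _ ∷ _) st W₂ q = no-misaligned′ W₁ st W₂ refl pr po

  Letters : Set
  Letters = List (Fin (suc K))

  edgeWord : Fin p → Fin p → Letters
  edgeWord x y with twin? x y
  ... | yes _ = map suc (v x y)
  ... | no _  = map suc (h x) ++ zero ∷ map suc (reverse (h y))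

  edgeWord-length : ∀ x y → length (edgeWord x y) ≡ suc (t + t)
  edgeWord-length x y with twin? x y
  ... | yes s = trans (length-map suc (v x y)) (v-length s)
  ... | no _  = begin
    length (map suc (h x) ++ zero ∷ map suc (reverse (h y)))            ≡⟨ length-++ (map suc (h x)) ⟩
    length (map suc (h x)) + suc (length (map suc (reverse (h y))))     ≡⟨ cong₂ (λ a b → a + suc b)
      (trans (length-map suc (h x)) (h-length x))
      (trans (length-map suc (reverse (h y))) (length-reverse-h y)) ⟩
    t + suc t                                                           ≡⟨ ℕ.+-suc t t ⟩
    suc (t + t)                                                         ∎
    where open ≡-Reasoning

  edgeWord-squarefree : ∀ x y → Squarefree (edgeWord x y)
  edgeWord-squarefree x y with twin? x y
  ... | yes s = squarefree-map suc Fin.suc-injective (v-squarefree s)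
  ... | no _  = squarefree-join (h-squarefree x) (squarefree-reverse (h-squarefree y))

  edgeWord-reverse : ∀ x y → reverse (edgeWord x y) ≡ edgeWord y x
  edgeWord-reverse x y with twin? x y | twin? y x
  ... | yes s | yes s′ = trans (sym (reverse-map suc (v x y))) (cong (map suc) (sym (v-reverse s′)))
  ... | yes s | no n   = ⊥-elim (n (twin-sym s))
  ... | no n  | yes s  = ⊥-elim (n (twin-sym s))
  ... | no n  | no _   = begin
    reverse (map suc (h x) ++ zero ∷ map suc (reverse (h y)))            ≡⟨ reverse-++ (map suc (h x)) _ ⟩
    reverse (zero ∷ map suc (reverse (h y))) ++ reverse (map suc (h x))  ≡⟨ cong (_++ reverse (map suc (h x))) (unfold-reverse zero (map suc (reverse (h y)))) ⟩
    (reverse (map suc (reverse (h y))) ∷ʳ zero) ++ reverse (map suc (h x)) ≡⟨ ++-assoc (reverse (map suc (reverse (h y)))) _ _ ⟩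
    reverse (map suc (reverse (h y))) ++ zero ∷ reverse (map suc (h x))  ≡⟨ cong₂ (λ a b → a ++ zero ∷ b)
      (trans (sym (reverse-map suc (reverse (h y)))) (cong (map suc) (reverse-involutive (h y))))
      (sym (reverse-map suc (h x))) ⟩
    map suc (h y) ++ zero ∷ map suc (reverse (h x))                      ∎
    where open ≡-Reasoning

  -- The colours seen on a path of the subdivision after a vertex coloured x of the original graph,
  -- and the colours in the original graph of the original vertices met.
  data Trail (x : Fin p) : Letters → List (Fin p) → Set where
    end  : Trail x [] []
    stop : ∀ {T} y m → x ≢ y → edgeWord x y ≡ T ++ m → Trail x T []
    pass : ∀ {y T cs} → x ≢ y → Trail y T cs → Trail x (edgeWord x y ++ zero ∷ T) (y ∷ cs)

  trail-walk : ∀ {x T cs} → Trail x T cs →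
               ∃₂ λ ws r → ∃₂ λ post (W : Walk (orig x) ws r) →
               PostOk r post × zero ∷ T ≡ encs (ws ∷ʳ post) × origs W ≡ x ∷ cs
  trail-walk end = [] , _ , [] , [] , inj₁ refl , refl , refl
  trail-walk {x} {T} (stop y m x≢y e) with twin? x y
  ... | yes s with b , b′ , q , refl , _ ← map-++⁻ suc (v x y) T e =
    [] , _ , b , [] , inj₂ (_ , b′ , thru s (sym q)) , cong (zero ∷_) (sym (++-identityʳ _)) , refl
  ... | no n with join-split (h x) T e
  ...   | inj₁ (b , b′ , q , refl , _) =
    [] , _ , b , [] , inj₂ (_ , b′ , out (x≢y , n) (sym q)) , cong (zero ∷_) (sym (++-identityʳ _)) , refl
  ...   | inj₂ (b , b′ , q , refl , _) =
    h x ∷ [] , _ , b , out (x≢y , n) refl ∷ [] , inj₂ (_ , b′ , into (x≢y , n) (sym q)) ,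
    cong (λ z → zero ∷ map suc (h x) ++ zero ∷ z) (sym (++-identityʳ _)) , refl
  trail-walk {x} (pass {y} {T} x≢y tr) with twin? x y | trail-walk tr
  ... | yes s | ws , r , post , W , po , e , o =
    v x y ∷ ws , r , post , thru s refl ∷ W , po , cong (λ z → zero ∷ map suc (v x y) ++ z) e , cong (x ∷_) o
  ... | no n  | ws , r , post , W , po , e , o =
    h x ∷ reverse (h y) ∷ ws , r , post , out (x≢y , n) refl ∷ into (x≢y , n) refl ∷ W , po ,
    cong (zero ∷_) (trans (++-assoc (map suc (h x)) _ _)
      (cong (λ z → map suc (h x) ++ zero ∷ map suc (reverse (h y)) ++ z) e)) ,
    cong (x ∷_) o

  -- The trail leaves `x` but is read towards `x`, which reverses every step: an edge abandoned in
  -- its second half contributes the state `mid y x` and the word `reverse (h x)`. Quantifying over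
  -- `bs` and `W` allows gluing to the walk that continues from `x`; no original colour is added.
  lead-walk : ∀ {x S} → Trail x S [] →
              ∃₂ λ s ws → ∃ λ pre → PreOk s pre ×
              (∀ bs → reverse S ++ encs bs ≡ map suc pre ++ encs (ws ++ bs)) ×
              (∀ {ws′ r} (W : Walk (orig x) ws′ r) → ∃ λ (W′ : Walk s (ws ++ ws′) r) → origs W′ ≡ origs W)
  lead-walk end = _ , [] , [] , inj₁ refl , (λ _ → refl) , λ W → W , refl
  lead-walk {x} {S} (stop y m x≢y e) with twin? x y
  ... | yes s with b , b′ , q , refl , _ ← map-++⁻ suc (v x y) S e =
    _ , [] , reverse b ,
    inj₂ (_ , reverse b′ , thru (twin-sym s) (trans (sym (reverse-++ b b′)) (trans (cong reverse (sym q)) (sym (v-reverse (twin-sym s)))))) ,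
    (λ bs → cong (_++ encs bs) (sym (reverse-map suc b))) , λ W → W , refl
  ... | no n with join-split (h x) S e
  ...   | inj₁ (b , b′ , q , refl , _) =
    _ , [] , reverse b ,
    inj₂ (mid y x , reverse b′ , into (normal-sym (x≢y , n)) (trans (sym (reverse-++ b b′)) (cong reverse (sym q)))) ,
    (λ bs → cong (_++ encs bs) (sym (reverse-map suc b))) , λ W → W , refl
  ...   | inj₂ (b , b′ , q , refl , _) =
    mid y x , reverse (h x) ∷ [] , reverse b ,
    inj₂ (orig y , reverse b′ , out ns (trans (sym (reverse-++ b b′)) (sym (reverse≡⇒≡reverse q)))) ,
    (λ bs → begin
      reverse (map suc (h x) ++ zero ∷ map suc b) ++ encs bs ≡⟨ cong (_++ encs bs) (reverse-++ (map suc (h x)) _) ⟩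
      (reverse (zero ∷ map suc b) ++ reverse (map suc (h x))) ++ encs bs ≡⟨ ++-assoc (reverse (zero ∷ map suc b)) _ _ ⟩
      reverse (zero ∷ map suc b) ++ reverse (map suc (h x)) ++ encs bs ≡⟨ cong (_++ (reverse (map suc (h x)) ++ encs bs)) (unfold-reverse zero (map suc b)) ⟩
      (reverse (map suc b) ∷ʳ zero) ++ reverse (map suc (h x)) ++ encs bs ≡⟨ ++-assoc (reverse (map suc b)) _ _ ⟩
      reverse (map suc b) ++ zero ∷ reverse (map suc (h x)) ++ encs bs ≡⟨ cong₂ (λ a c → a ++ zero ∷ c ++ encs bs) (reverse-map suc b) (reverse-map suc (h x)) ⟨
      map suc (reverse b) ++ zero ∷ map suc (reverse (h x)) ++ encs bs ∎) ,
    λ W → into ns refl ∷ W , refl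
    where
    open ≡-Reasoning
    ns = normal-sym (x≢y , n)

  trail-not-square : ∀ {x S T cs X} → Trail x S [] → Trail x T cs → Squarefree (x ∷ cs) →
                     reverse S ++ zero ∷ T ≢ X ++ X
  trail-not-square {S = S} {X = X} tr₁ tr₂ sf e
    with ws , r , post , W , po , q , o ← trail-walk tr₂
    with s , ws₀ , pre , pr , q₀ , ext ← lead-walk tr₁
    with W′ , o′ ← ext W =
    no-square {X = X} W′ pr po (subst Squarefree (sym (trans o′ o)) sf)
      (trans (cong (λ z → map suc pre ++ encs z) (++-assoc ws₀ ws _))
        (trans (sym (q₀ (ws ∷ʳ post))) (trans (cong (reverse S ++_) (sym q)) e)))

-- Paths of the subdivision

module Paths (H : AdjStr) (adj-sym : ∀ {x y} → Adj H x y → Adj H y x) where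

  path-tail : ∀ {x xs} → IsPath H (x ∷ xs) → IsPath H xs
  path-tail (_ ∷ u , [-])   = u , []
  path-tail (_ ∷ u , _ ∷ l) = u , l

  path-suffix : ∀ as {bs} → IsPath H (as ++ bs) → IsPath H bs
  path-suffix []       π = π
  path-suffix (_ ∷ as) π = path-suffix as (path-tail π)

  linked-snoc : ∀ xs {a b} → Linked (Adj H) (xs ∷ʳ a) → Adj H a b → Linked (Adj H) ((xs ∷ʳ a) ∷ʳ b)
  linked-snoc []           [-]      r = r ∷ [-]
  linked-snoc (x ∷ [])     (q ∷ [-]) r = q ∷ r ∷ [-]
  linked-snoc (x ∷ y ∷ xs) (q ∷ l)  r = q ∷ linked-snoc (y ∷ xs) l r

  linked-reverse : ∀ {xs} → Linked (Adj H) xs → Linked (Adj H) (reverse xs)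
  linked-reverse []  = []
  linked-reverse [-] = [-]
  linked-reverse {x ∷ y ∷ xs} (r ∷ l) =
    subst (Linked (Adj H)) (sym (trans (unfold-reverse x (y ∷ xs)) (cong (_∷ʳ x) (unfold-reverse y xs))))
      (linked-snoc (reverse xs) (subst (Linked (Adj H)) (unfold-reverse y xs) (linked-reverse l)) (adj-sym r))

  unique-snoc : ∀ {xs : List (V H)} {b} → Unique xs → All (_≢ b) xs → Unique (xs ∷ʳ b)
  unique-snoc []      []      = [] ∷ []
  unique-snoc (q ∷ u) (r ∷ a) = All.++⁺ q (r ∷ []) ∷ unique-snoc u a

  unique-reverse : ∀ {xs : List (V H)} → Unique xs → Unique (reverse xs)
  unique-reverse [] = []
  unique-reverse {x ∷ xs} (q ∷ u) = subst Unique (sym (unfold-reverse x xs))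
    (unique-snoc (unique-reverse u) (All-resp-↭ (↭-sym (↭-reverse xs)) (All.map (λ n e → n (sym e)) q)))

  path-reverse : ∀ {xs} → IsPath H xs → IsPath H (reverse xs)
  path-reverse (u , l) = unique-reverse u , linked-reverse l

  path-prefix : ∀ as {bs} → IsPath H (as ++ bs) → IsPath H as
  path-prefix as {bs} π = subst (IsPath H) (reverse-involutive as)
    (path-reverse (path-suffix (reverse bs) (subst (IsPath H) (reverse-++ as bs) (path-reverse π))))

  -- Factors of a path are again paths, so a square among the colours comes from a repetitively
  -- coloured subpath.
  nonrepetitive⇒squarefree : ∀ {k φ} → Nonrepetitive H k φ → ∀ {xs} → IsPath H xs → Squarefree (map φ xs)
  nonrepetitive⇒squarefree {φ = φ} nr {xs} π l u r e
    with as , _ , refl , _ , e₁ ← map-++⁻ φ xs l e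
    with bs , _ , refl , refl , e₂ ← map-++⁻ φ _ u (sym e₁)
    with cs , ds , refl , e₃ , _ ← map-++⁻ φ _ (map φ bs) (sym e₂)
    with bs
  ... | []     = refl
  ... | b ∷ bs = ⊥-elim (nr ((b ∷ bs) ++ cs)
          (path-prefix ((b ∷ bs) ++ cs) (subst (IsPath H) (sym (++-assoc (b ∷ bs) cs ds)) (path-suffix as π)))
          (b ∷ bs , cs , refl , s≤s z≤n ,
           trans (sym (length-map φ (b ∷ bs))) (trans (cong length e₃) (length-map φ cs)) , e₃))

  -- A walk in H all of whose inner vertices have no neighbours off the walk.
  data Thread : List (V H) → Set where
    edge : ∀ {a b} → Thread (a ∷ b ∷ [])
    bend : ∀ {a b c l} → (∀ z → Adj H b z → z ≡ a ⊎ z ≡ c) → Thread (b ∷ c ∷ l) → Thread (a ∷ b ∷ c ∷ l)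

  thread-suffix : ∀ as {a b l} → Thread (as ++ a ∷ b ∷ l) → Thread (a ∷ b ∷ l)
  thread-suffix []               τ          = τ
  thread-suffix (_ ∷ [])         (bend _ τ) = τ
  thread-suffix (_ ∷ a ∷ [])     (bend _ τ) = thread-suffix (a ∷ []) τ
  thread-suffix (_ ∷ a ∷ b ∷ as) (bend _ τ) = thread-suffix (a ∷ b ∷ as) τ

  -- At an inner vertex of the thread the only neighbours are the previous vertex, which a path may
  -- not revisit, and the next one. So the path and the thread agree until one of them ends.
  follow : ∀ {a b l xs} → Thread (a ∷ b ∷ l) → IsPath H (a ∷ b ∷ xs) →
           (∃ λ m → l ≡ xs ++ m) ⊎ (∃ λ m → xs ≡ l ++ m)
  follow {xs = xs} edge π = inj₂ (xs , refl)
  follow {xs = []} (bend {c = c} {l} _ _) π = inj₁ (c ∷ l , refl)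
  follow {xs = x ∷ xs} (bend n τ) π@((_ ∷ a≢x ∷ _) ∷ _ , _ ∷ b~x ∷ _) with n x b~x
  ... | inj₁ refl = ⊥-elim (a≢x refl)
  ... | inj₂ refl with follow τ (path-tail π)
  ...   | inj₁ (m , refl) = inj₁ (m , refl)
  ...   | inj₂ (m , refl) = inj₂ (m , refl)

  thread-up : ∀ (f : ℕ → V H) n → (∀ k → k < n → ∀ z → Adj H (f (suc k)) z → z ≡ f k ⊎ z ≡ f (2 + k)) →
              Thread (applyUpTo f (2 + n))
  thread-up f zero    nb = edge
  thread-up f (suc n) nb = bend (nb 0 (s≤s z≤n)) (thread-up (λ k → f (suc k)) n (λ k k<n → nb (suc k) (s≤s k<n)))

  thread-down : ∀ (f : ℕ → V H) n → (∀ k → k < n → ∀ z → Adj H (f (suc k)) z → z ≡ f k ⊎ z ≡ f (2 + k)) →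
                Thread (applyDownFrom f (2 + n))
  thread-down f zero    nb = edge
  thread-down f (suc n) nb = bend (λ z a → Sum.swap (nb n ℕ.≤-refl z a)) (thread-down f n (λ k k<n → nb k (ℕ.m<n⇒m<1+n k<n)))

applyUpTo-split : ∀ {A : Set} (f : ℕ → A) n k → k ≤ n → ∃₂ λ as bs → applyUpTo f (2 + n) ≡ as ++ f k ∷ f (suc k) ∷ bs
applyUpTo-split f n       zero    _       = [] , applyUpTo (λ k → f (2 + k)) n , refl
applyUpTo-split f (suc n) (suc k) (s≤s q) with as , bs , e ← applyUpTo-split (λ k → f (suc k)) n k q =
  f 0 ∷ as , bs , cong (f 0 ∷_) e

applyDownFrom-split : ∀ {A : Set} (f : ℕ → A) n k → k ≤ n → ∃₂ λ as bs → applyDownFrom f (2 + n) ≡ as ++ f (suc k) ∷ f k ∷ bs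
applyDownFrom-split f n k k≤n with as , bs , e ← applyUpTo-split f n k k≤n = reverse bs , reverse as , (begin
  applyDownFrom f (2 + n)                        ≡⟨ reverse-applyUpTo f (2 + n) ⟨
  reverse (applyUpTo f (2 + n))                  ≡⟨ cong reverse e ⟩
  reverse (as ++ f k ∷ f (suc k) ∷ bs)           ≡⟨ reverse-++ as _ ⟩
  reverse (f k ∷ f (suc k) ∷ bs) ++ reverse as   ≡⟨ cong (_++ reverse as) (trans (unfold-reverse (f k) (f (suc k) ∷ bs)) (cong (_∷ʳ f k) (unfold-reverse (f (suc k)) bs))) ⟩
  ((reverse bs ∷ʳ f (suc k)) ∷ʳ f k) ++ reverse as ≡⟨ ++-assoc (reverse bs ∷ʳ f (suc k)) _ _ ⟩
  (reverse bs ∷ʳ f (suc k)) ++ f k ∷ reverse as  ≡⟨ ++-assoc (reverse bs) _ _ ⟩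
  reverse bs ++ f (suc k) ∷ f k ∷ reverse as     ∎)
  where open ≡-Reasoning

applyUpTo-tabulate : ∀ {A : Set} (f : ℕ → A) n → applyUpTo f n ≡ tabulate {n = n} (λ j → f (toℕ j))
applyUpTo-tabulate f zero    = refl
applyUpTo-tabulate f (suc n) = cong (f 0 ∷_) (applyUpTo-tabulate (λ k → f (suc k)) n)

tabulate-lookup-subst : ∀ {A : Set} (w : List A) {n} (e : n ≡ length w) → tabulate (λ j → lookup w (subst Fin e j)) ≡ w
tabulate-lookup-subst w refl = tabulate-lookup w

-- The colouring of the subdivision and its paths

module Colouring (G : Graph) (t d : ℕ) (d≡ : d ≡ suc (t + t)) {p K : ℕ} (code : Code p K t)
                 (φ : Fin (Graph.n G) → Fin p) (nr : Nonrepetitive (toAdj G) p φ) where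
  open Graph G
  open Walks code

  H : AdjStr
  H = subdivision G d

  src tgt : Fin (length edges) → Fin n
  src i = proj₁ (lookup edges i)
  tgt i = proj₂ (lookup edges i)

  GAdj : Fin n → Fin n → Set
  GAdj = Adj (toAdj G)

  open Paths H Sum.swap
  module GPaths = Paths (toAdj G) Sum.swap

  adj⇒≢ : ∀ {u v} → GAdj u v → u ≢ v
  adj⇒≢ (inj₁ e) refl = Fin.<-irrefl refl (All.lookup ordered e)
  adj⇒≢ (inj₂ e) refl = Fin.<-irrefl refl (All.lookup ordered e)

  adj⇒colours≢ : ∀ {u v} → GAdj u v → φ u ≢ φ v
  adj⇒colours≢ {u} {v} a e = nr (u ∷ v ∷ []) ((adj⇒≢ a ∷ []) ∷ [] ∷ [] , a ∷ [-])
    (u ∷ [] , v ∷ [] , refl , s≤s z≤n , refl , cong (_∷ []) e)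

  word : Fin (length edges) → Letters
  word i = edgeWord (φ (src i)) (φ (tgt i))

  d≡length : ∀ i → d ≡ length (word i)
  d≡length i = trans d≡ (sym (edgeWord-length (φ (src i)) (φ (tgt i))))

  colour : V H → Fin (suc K)
  colour (inj₁ _)       = zero
  colour (inj₂ (i , j)) = lookup (word i) (subst Fin (d≡length i) j)

  data Inner : V H → Set where
    inner : ∀ i j → Inner (inj₂ (i , j))

  -- A subdivided edge as seen from its end `u`. Each edge yields one for either direction, so that
  -- the arguments about paths do not depend on how the edge is stored.
  record Track (u w : Fin n) : Set where
    field
      inside : List (V H)
      inside-inner : All Inner inside
      inside-colours : map colour inside ≡ edgeWord (φ u) (φ w)
      ends-adjacent : GAdj u w
      thread : Thread (inj₁ u ∷ inside ∷ʳ inj₁ w)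

  -- The vertices of the i-th subdivided edge, numbered from 0 to 1 + d; larger numbers stand for its target.
  at : Fin (length edges) → ℕ → V H
  at i zero = inj₁ (src i)
  at i (suc k) with k <? d
  ... | yes k<d = inj₂ (i , fromℕ< k<d)
  ... | no _    = inj₁ (tgt i)

  at-inner : ∀ i (j : Fin d) → at i (suc (toℕ j)) ≡ inj₂ (i , j)
  at-inner i j with toℕ j <? d
  ... | yes j<d = cong (λ j → inj₂ (i , j)) (Fin.fromℕ<-toℕ j j<d)
  ... | no ¬j<d = ⊥-elim (¬j<d (Fin.toℕ<n j))

  at-tgt : ∀ i → at i (suc d) ≡ inj₁ (tgt i)
  at-tgt i with d <? d
  ... | yes d<d = ⊥-elim (ℕ.<-irrefl refl d<d)
  ... | no _    = refl

  at-neighbours : ∀ i k → k < d → ∀ z → Adj H (at i (suc k)) z → z ≡ at i k ⊎ z ≡ at i (2 + k)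
  at-neighbours i k k<d z a with k <? d
  ... | no ¬k<d = ⊥-elim (¬k<d k<d)
  ... | yes q with a
  ...   | inj₁ (mid _ _ l e)   = inj₂ (sym (trans (cong (λ k → at i (suc k)) (trans (cong suc (sym (Fin.toℕ-fromℕ< q))) e)) (at-inner i l)))
  ...   | inj₁ (last _ _ e)    = inj₂ (sym (trans (cong (λ k → at i (suc k)) (trans (cong suc (sym (Fin.toℕ-fromℕ< q))) e)) (at-tgt i)))
  ...   | inj₂ (first _ _ e)   = inj₁ (cong (at i) (trans (sym e) (Fin.toℕ-fromℕ< q)))
  ...   | inj₂ (mid _ j _ e)   = inj₁ (sym (trans (cong (at i) (trans (sym (Fin.toℕ-fromℕ< q)) (sym e))) (at-inner i j)))

  internal : Fin (length edges) → List (V H)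
  internal i = tabulate (λ j → inj₂ (i , j))

  at-up : ∀ i → applyUpTo (at i) (2 + d) ≡ inj₁ (src i) ∷ internal i ∷ʳ inj₁ (tgt i)
  at-up i = cong (inj₁ (src i) ∷_) (begin
    applyUpTo (λ k → at i (suc k)) (suc d)              ≡⟨ applyUpTo-∷ʳ (λ k → at i (suc k)) d ⟨
    applyUpTo (λ k → at i (suc k)) d ∷ʳ at i (suc d)    ≡⟨ cong₂ _∷ʳ_ (trans (applyUpTo-tabulate (λ k → at i (suc k)) d) (tabulate-cong (at-inner i))) (at-tgt i) ⟩
    internal i ∷ʳ inj₁ (tgt i)                          ∎)
    where open ≡-Reasoning

  at-down : ∀ i → applyDownFrom (at i) (2 + d) ≡ inj₁ (tgt i) ∷ reverse (internal i) ∷ʳ inj₁ (src i)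
  at-down i = begin
    applyDownFrom (at i) (2 + d)                              ≡⟨ reverse-applyUpTo (at i) (2 + d) ⟨
    reverse (applyUpTo (at i) (2 + d))                        ≡⟨ cong reverse (at-up i) ⟩
    reverse (inj₁ (src i) ∷ internal i ∷ʳ inj₁ (tgt i))       ≡⟨ unfold-reverse (inj₁ (src i)) (internal i ∷ʳ inj₁ (tgt i)) ⟩
    reverse (internal i ∷ʳ inj₁ (tgt i)) ∷ʳ inj₁ (src i)      ≡⟨ cong (_∷ʳ inj₁ (src i)) (reverse-snoc (internal i) (inj₁ (tgt i))) ⟩
    inj₁ (tgt i) ∷ reverse (internal i) ∷ʳ inj₁ (src i)       ∎
    where open ≡-Reasoning

  internal-inner : ∀ i → All Inner (internal i)
  internal-inner i = All.tabulate⁺ (inner i)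

  internal-colours : ∀ i → map colour (internal i) ≡ word i
  internal-colours i = trans (map-tabulate (λ j → inj₂ (i , j)) colour) (tabulate-lookup-subst (word i) (d≡length i))

  forward : ∀ i → Track (src i) (tgt i)
  forward i = record
    { inside         = internal i
    ; inside-inner   = internal-inner i
    ; inside-colours = internal-colours i
    ; ends-adjacent  = inj₁ (∈-lookup i)
    ; thread         = subst Thread (at-up i) (thread-up (at i) d (at-neighbours i))
    }

  backward : ∀ i → Track (tgt i) (src i)
  backward i = record
    { inside         = reverse (internal i)
    ; inside-inner   = All-resp-↭ (↭-sym (↭-reverse (internal i))) (internal-inner i)
    ; inside-colours = trans (reverse-map colour (internal i))
                         (trans (cong reverse (internal-colours i)) (edgeWord-reverse (φ (src i)) (φ (tgt i))))
    ; ends-adjacent  = inj₂ (∈-lookup i)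
    ; thread         = subst Thread (at-down i) (thread-down (at i) d (at-neighbours i))
    }

  enter : ∀ {u y} → Adj H (inj₁ u) y → Inner y → ∃₂ λ w (τ : Track u w) → ∃ λ l → Track.inside τ ∷ʳ inj₁ w ≡ y ∷ l
  enter (inj₁ (first i j e)) _ = tgt i , forward i , l ,
    trans (sym (∷-injectiveʳ (at-up i)))
      (cong (_∷ l) (trans (cong (λ k → at i (suc k)) (sym e)) (at-inner i j)))
    where l = applyUpTo (λ k → at i (2 + k)) d
  enter (inj₂ (last i j e)) _ = src i , backward i , applyDownFrom (at i) d ,
    trans (sym (∷-injectiveʳ (at-down i)))
      (cong (_∷ applyDownFrom (at i) d) (trans (cong (at i) (sym e)) (at-inner i j)))

  originals : List (V H) → List (Fin n)
  originals = mapMaybe isInj₁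

  originals-inner : ∀ {xs} → All Inner xs → originals xs ≡ []
  originals-inner []             = refl
  originals-inner (inner _ _ ∷ a) = originals-inner a

  follow-track : ∀ {u w y l ys} (τ : Track u w) → Track.inside τ ∷ʳ inj₁ w ≡ y ∷ l → IsPath H (inj₁ u ∷ y ∷ ys) →
                 (∃ λ m → Track.inside τ ≡ (y ∷ ys) ++ m) ⊎ (∃ λ m → y ∷ ys ≡ Track.inside τ ++ inj₁ w ∷ m)
  follow-track {u} {w} {y} {l} {ys} τ e π with follow (subst Thread (cong (inj₁ u ∷_) e) (Track.thread τ)) π
  ... | inj₂ (m , refl) = inj₂ (m , trans (cong (_++ m) (sym e)) (++-assoc (Track.inside τ) _ m))
  ... | inj₁ (m , refl) with initLast m
  -- The path ends exactly at `w`; this counts as crossing, with nothing left after `w`.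
  ...   | []       = inj₂ ([] , trans (cong (y ∷_) (sym (++-identityʳ ys))) (sym e))
  ...   | m ∷ʳ′ z  = inj₁ (m , ∷ʳ-injectiveˡ (Track.inside τ) ((y ∷ ys) ++ m)
                       (trans e (cong (y ∷_) (sym (++-assoc ys m (z ∷ []))))))

  -- The adjacency part is carried along because the original vertices met must form a path of `G`
  -- before `nr` can be applied to them.
  TrailFrom : Fin n → List (V H) → Set
  TrailFrom u xs = Linked GAdj (u ∷ originals xs) × Trail (φ u) (map colour xs) (map φ (originals xs))

  trail-cross : ∀ {u w} (τ : Track u w) {xs} → TrailFrom w xs → TrailFrom u (Track.inside τ ++ inj₁ w ∷ xs)
  trail-cross {u} {w} τ {xs} (lk , tr) = subst (λ vs → Linked GAdj (u ∷ vs)) (sym originals≡) (ends-adjacent ∷ lk) ,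
    subst₂ (Trail (φ u))
      (trans (cong (_++ zero ∷ map colour xs) (sym inside-colours)) (sym (map-++ colour inside _)))
      (cong (map φ) (sym originals≡))
      (pass (adj⇒colours≢ ends-adjacent) tr)
    where
    open Track τ
    originals≡ : originals (inside ++ inj₁ w ∷ xs) ≡ w ∷ originals xs
    originals≡ = trans (mapMaybe-++ isInj₁ inside _) (cong (_++ w ∷ originals xs) (originals-inner inside-inner))

  trail-stop : ∀ {u w} (τ : Track u w) xs {m} → Track.inside τ ≡ xs ++ m → TrailFrom u xs
  trail-stop {u} {w} τ xs {m} e =
    subst (λ vs → Linked GAdj (u ∷ vs)) (sym originals≡) [-] ,
    subst (Trail (φ u) (map colour xs)) (cong (map φ) (sym originals≡))
      (stop (φ w) (map colour m) (adj⇒colours≢ ends-adjacent)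
        (trans (sym inside-colours) (trans (cong (map colour) e) (map-++ colour xs m))))
    where
    open Track τ
    originals≡ : originals xs ≡ []
    originals≡ = originals-inner (All.++⁻ˡ xs (subst (All Inner) e inside-inner))

  -- Each round either stops inside an edge or crosses it. The bound `m` drives the recursion, since
  -- the rest after a crossing is found by an equation and is not a structural part of the path.
  trail′ : ∀ m {u} xs → length xs ≤ m → IsPath H (inj₁ u ∷ xs) → TrailFrom u xs
  trail′ _ [] _ _ = [-] , end
  trail′ _ (inj₁ _ ∷ _) _ (_ , inj₁ (direct e _) ∷ _) with () ← trans (sym e) d≡
  trail′ _ (inj₁ _ ∷ _) _ (_ , inj₂ (direct e _) ∷ _) with () ← trans (sym e) d≡
  trail′ (suc m) {u} (inj₂ y ∷ ys) (s≤s len) π@(_ , a ∷ _) with enter a (inner _ _)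
  ... | w , τ , l , e with follow-track τ e π
  ...   | inj₁ (_ , q)    = trail-stop τ _ q
  ...   | inj₂ (rest , q) = subst (TrailFrom u) (sym q) (trail-cross τ
          (trail′ m rest rest≤ (path-suffix (inj₁ u ∷ Track.inside τ) (subst (λ xs → IsPath H (inj₁ u ∷ xs)) q π))))
    where
    open ℕ.≤-Reasoning
    rest≤ : length rest ≤ m
    rest≤ = ℕ.≤-trans (ℕ.≤-pred (begin
      suc (length rest)                                  ≤⟨ ℕ.m≤n+m _ (length (Track.inside τ)) ⟩
      length (Track.inside τ) + suc (length rest)        ≡⟨ length-++ (Track.inside τ) ⟨
      length (Track.inside τ ++ inj₁ w ∷ rest)           ≡⟨ cong length q ⟨
      suc (length ys)                                    ∎)) len

  trail : ∀ {u} xs → IsPath H (inj₁ u ∷ xs) → TrailFrom u xs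
  trail xs = trail′ (length xs) xs ℕ.≤-refl

  suffix-not-inner : ∀ {u w} (τ : Track u w) as {xs} → xs ≢ [] →
                     inj₁ u ∷ Track.inside τ ∷ʳ inj₁ w ≡ as ++ xs → ¬ All Inner xs
  suffix-not-inner {u} τ as {xs} xs≢[] e a with initLast xs
  ... | []      = xs≢[] refl
  ... | q ∷ʳ′ z with refl ← ∷ʳ-injectiveʳ (inj₁ u ∷ Track.inside τ) (as ++ q) (trans e (sym (++-assoc as q _)))
    with () ∷ [] ← All.++⁻ʳ q a

  -- The first two vertices fix an edge and a direction, and `follow` keeps the path on that track.
  -- It covers neither end of the track, since the ends are original vertices; hence its colours are
  -- a factor of the edge word.
  inner-factor : ∀ {u w} (τ : Track u w) as {x y bs ys} → inj₁ u ∷ Track.inside τ ∷ʳ inj₁ w ≡ as ++ x ∷ y ∷ bs →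
                 IsPath H (x ∷ y ∷ ys) → All Inner (x ∷ y ∷ ys) →
                 ∃₂ λ l r → edgeWord (φ u) (φ w) ≡ l ++ map colour (x ∷ y ∷ ys) ++ r
  inner-factor {u} τ as {x} {y} {bs} {ys} e π a with follow (thread-suffix as (subst Thread e (Track.thread τ))) π
  ... | inj₂ (m , refl) = ⊥-elim (suffix-not-inner τ as {x ∷ y ∷ bs} (λ ()) e (All.++⁻ˡ (x ∷ y ∷ bs) a))
  ... | inj₁ (m , refl) with initLast m
  ...   | []      = ⊥-elim (suffix-not-inner τ as {x ∷ y ∷ ys ++ []} (λ ()) e
                      (subst (λ zs → All Inner (x ∷ y ∷ zs)) (sym (++-identityʳ ys)) a))
  ...   | m ∷ʳ′ z with as | ∷ʳ-injectiveˡ (inj₁ u ∷ Track.inside τ) (as ++ (x ∷ y ∷ ys) ++ m)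
                              (trans e (trans (cong (λ q → as ++ x ∷ y ∷ q) (sym (++-assoc ys m (z ∷ []))))
                                (sym (++-assoc as ((x ∷ y ∷ ys) ++ m) (z ∷ [])))))
  ...     | []      | refl with () ∷ _ ← a
  ...     | _ ∷ as  | q = map colour as , map colour m , (begin
              edgeWord (φ u) _                                        ≡⟨ Track.inside-colours τ ⟨
              map colour (Track.inside τ)                             ≡⟨ cong (map colour) (∷-injectiveʳ q) ⟩
              map colour (as ++ (x ∷ y ∷ ys) ++ m)                    ≡⟨ map-++ colour as _ ⟩
              map colour as ++ map colour ((x ∷ y ∷ ys) ++ m)         ≡⟨ cong (map colour as ++_) (map-++ colour (x ∷ y ∷ ys) m) ⟩
              map colour as ++ map colour (x ∷ y ∷ ys) ++ map colour m ∎)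
    where open ≡-Reasoning

  squarefree-inner : ∀ {x y ys} → IsPath H (x ∷ y ∷ ys) → All Inner (x ∷ y ∷ ys) → Squarefree (map colour (x ∷ y ∷ ys))
  squarefree-inner π@(_ , inj₁ (mid i j k e) ∷ _) a
    with as , bs , q ← applyUpTo-split (at i) d (toℕ k) (ℕ.<⇒≤ (Fin.toℕ<n k))
    with l , r , q′ ← inner-factor (forward i) as
           (trans (sym (at-up i)) (trans q (cong₂ (λ y z → as ++ y ∷ z ∷ bs)
             (trans (cong (at i) (sym e)) (at-inner i j)) (at-inner i k)))) π a
    = squarefree-factor l r (subst Squarefree q′ (edgeWord-squarefree (φ (src i)) (φ (tgt i))))
  squarefree-inner π@(_ , inj₂ (mid i k j e) ∷ _) a
    with as , bs , q ← applyDownFrom-split (at i) d (toℕ j) (ℕ.<⇒≤ (Fin.toℕ<n j))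
    with l , r , q′ ← inner-factor (backward i) as
           (trans (sym (at-down i)) (trans q (cong₂ (λ y z → as ++ y ∷ z ∷ bs)
             (at-inner i j) (trans (cong (at i) (sym e)) (at-inner i k))))) π a
    = squarefree-factor l r (subst Squarefree q′ (edgeWord-squarefree (φ (tgt i)) (φ (src i))))
  squarefree-inner (_ , inj₁ (first _ _ _) ∷ _) (() ∷ _)
  squarefree-inner (_ , inj₁ (last _ _ _) ∷ _) (_ ∷ () ∷ _)
  squarefree-inner (_ , inj₁ (direct _ _) ∷ _) (() ∷ _)
  squarefree-inner (_ , inj₂ (first _ _ _) ∷ _) (_ ∷ () ∷ _)
  squarefree-inner (_ , inj₂ (last _ _ _) ∷ _) (() ∷ _)
  squarefree-inner (_ , inj₂ (direct _ _) ∷ _) (() ∷ _)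

  originals-unique : ∀ {xs} → Unique xs → Unique (originals xs)
  originals-unique []                    = []
  originals-unique {inj₂ _ ∷ _}  (_ ∷ u) = originals-unique u
  originals-unique {inj₁ x ∷ xs} (q ∷ u) = fresh q ∷ originals-unique u
    where
    fresh : ∀ {xs} → All (inj₁ x ≢_) xs → All (x ≢_) (originals xs)
    fresh []                    = []
    fresh {inj₁ _ ∷ _} (q ∷ qs) = (λ e → q (cong inj₁ e)) ∷ fresh qs
    fresh {inj₂ _ ∷ _} (_ ∷ qs) = fresh qs

  first-original : ∀ xs → All Inner xs ⊎ ∃ λ as → ∃₂ λ u bs → xs ≡ as ++ inj₁ u ∷ bs × All Inner as
  first-original []            = inj₁ []
  first-original (inj₁ u ∷ xs) = inj₂ ([] , u , xs , refl , [])
  first-original (inj₂ y ∷ xs) with first-original xs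
  ... | inj₁ a                       = inj₁ (inner _ _ ∷ a)
  ... | inj₂ (as , u , bs , refl , a) = inj₂ (inj₂ y ∷ as , u , bs , refl , inner _ _ ∷ a)

  -- A path without original vertices stays inside one edge, whose word is squarefree. Any other
  -- path is read in both directions from its first original vertex `u`; by this choice the backward
  -- trail meets no further original vertex.
  nonrepetitive : Nonrepetitive H (suc K) colour
  nonrepetitive xs π ([] , _ , _ , () , _)
  nonrepetitive _ π (y ∷ ys , z ∷ zs , refl , _ , len , e) with first-original (y ∷ ys ++ z ∷ zs)
  ... | inj₁ a with ys
  ...   | []     with () ← squarefree-inner π a [] (map colour (y ∷ [])) [] (cong (colour y ∷_) (trans (sym e) (sym (++-identityʳ _))))
  ...   | x ∷ ys with () ← squarefree-inner π a [] (map colour (y ∷ x ∷ ys)) []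
            (trans (map-++ colour (y ∷ x ∷ ys) (z ∷ zs)) (cong (map colour (y ∷ x ∷ ys) ++_) (trans (sym e) (sym (++-identityʳ _)))))
  nonrepetitive _ π (y ∷ ys , z ∷ zs , refl , _ , len , e) | inj₂ (as , u , bs , q , a) =
    trail-not-square {X = map colour (y ∷ ys)} back (proj₂ onward) squarefree-originals (begin
      reverse (map colour (reverse as)) ++ zero ∷ map colour bs  ≡⟨ cong (_++ zero ∷ map colour bs) (sym (reverse-map colour (reverse as))) ⟩
      map colour (reverse (reverse as)) ++ zero ∷ map colour bs  ≡⟨ cong (λ l → map colour l ++ zero ∷ map colour bs) (reverse-involutive as) ⟩
      map colour as ++ map colour (inj₁ u ∷ bs)                  ≡⟨ map-++ colour as _ ⟨
      map colour (as ++ inj₁ u ∷ bs)                             ≡⟨ cong (map colour) q ⟨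
      map colour ((y ∷ ys) ++ (z ∷ zs))                          ≡⟨ map-++ colour (y ∷ ys) _ ⟩
      map colour (y ∷ ys) ++ map colour (z ∷ zs)                 ≡⟨ cong (map colour (y ∷ ys) ++_) (sym e) ⟩
      map colour (y ∷ ys) ++ map colour (y ∷ ys)                 ∎)
    where
    open ≡-Reasoning
    π′ : IsPath H (as ++ inj₁ u ∷ bs)
    π′ = subst (IsPath H) q π
    onward : TrailFrom u bs
    onward = trail bs (path-suffix as π′)
    back : Trail (φ u) (map colour (reverse as)) []
    back = subst (Trail (φ u) (map colour (reverse as)))
      (cong (map φ) (originals-inner (All-resp-↭ (↭-sym (↭-reverse as)) a)))
      (proj₂ (trail (reverse as) (subst (IsPath H) (reverse-snoc as (inj₁ u))
        (path-reverse (path-prefix (as ∷ʳ inj₁ u) (subst (IsPath H) (sym (++-assoc as (inj₁ u ∷ []) bs)) π′))))))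
    squarefree-originals : Squarefree (map φ (u ∷ originals bs))
    squarefree-originals = GPaths.nonrepetitive⇒squarefree nr
      (originals-unique (proj₁ (path-suffix as π′)) , proj₁ onward)

-- Counting squarefree words

module _ {A : Set} where
  open ℕ.≤-Reasoning

  unique-⊆-length : ∀ {xs ys : List A} → Unique xs → (∀ {x} → x ∈ xs → x ∈ ys) → length xs ≤ length ys
  unique-⊆-length [] _ = z≤n
  unique-⊆-length {x ∷ xs} {ys} (x∉ ∷ u) sub with as , bs , refl ← ∈-∃++ (sub (here refl)) = begin
    suc (length xs)              ≤⟨ s≤s (unique-⊆-length u sub′) ⟩
    suc (length (as ++ bs))      ≡⟨ cong suc (length-++ as) ⟩
    suc (length as + length bs)  ≡⟨ ℕ.+-suc (length as) _ ⟨
    length as + suc (length bs)  ≡⟨ length-++ as ⟨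
    length (as ++ x ∷ bs)        ∎
    where
    sub′ : ∀ {y} → y ∈ xs → y ∈ as ++ bs
    sub′ y∈ with ∈-++⁻ as (sub (there y∈))
    ... | inj₁ q           = ∈-++⁺ˡ q
    ... | inj₂ (here refl) = ⊥-elim (All.lookup x∉ y∈ refl)
    ... | inj₂ (there q)   = ∈-++⁺ʳ as q

  length-filter-¬ : ∀ {P : A → Set} (P? : Decidable P) xs →
                    length (filter P? xs) + length (filter (λ x → ¬? (P? x)) xs) ≡ length xs
  length-filter-¬ P? [] = refl
  length-filter-¬ P? (x ∷ xs) with P? x
  ... | yes _ = cong suc (length-filter-¬ P? xs)
  ... | no _  = trans (ℕ.+-suc _ _) (cong suc (length-filter-¬ P? xs))

  length-cartesianProductWith : ∀ {B C : Set} (f : A → B → C) xs ys →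
                                length (cartesianProductWith f xs ys) ≡ length xs * length ys
  length-cartesianProductWith f []       ys = refl
  length-cartesianProductWith f (x ∷ xs) ys =
    trans (length-++ (map (f x) ys)) (cong₂ _+_ (length-map (f x) ys) (length-cartesianProductWith f xs ys))

module Counting (K : ℕ) where
  Word : Set
  Word = List (Fin K)

  -- Undoes the deletion of the first half of a prefix square: what remains starts with a copy of
  -- the deleted half.
  prepend : ℕ → Word → Word
  prepend s q = take s q ++ q

  -- w starts with a square of half-length suc s.
  PrefixSquareOf : Word → ℕ → Set
  PrefixSquareOf w s = w ≡ prepend (suc s) (drop (suc s) w)

  PrefixSquare : Word → Set
  PrefixSquare w = Any (PrefixSquareOf w) (upTo (length w))

  prefixSquare? : Decidable PrefixSquare
  prefixSquare? w = any? (λ s → ≡-dec Fin._≟_ w _) (upTo (length w))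

  -- Letters are added in front of words that are already squarefree, so a new square can only be a
  -- prefix.
  words : ℕ → List Word
  extensions : ℕ → List Word
  words zero    = [] ∷ []
  words (suc n) = filter (λ w → ¬? (prefixSquare? w)) (extensions n)
  extensions n  = cartesianProductWith _∷_ (allFin K) (words n)

  extensions-unique : ∀ n → Unique (words n) → Unique (extensions n)
  extensions-unique n u = Unique.cartesianProductWith⁺ _∷_ ∷-injective (Unique.allFin⁺ K) u

  words-unique : ∀ n → Unique (words n)
  words-unique zero    = [] ∷ []
  words-unique (suc n) = Unique.filter⁺ _ (extensions-unique n (words-unique n))

  take-++-length : ∀ (u : Word) r → take (length u) (u ++ r) ≡ u
  take-++-length []      r = refl
  take-++-length (x ∷ u) r = cong (x ∷_) (take-++-length u r)

  drop-++-length : ∀ (u : Word) r → drop (length u) (u ++ r) ≡ r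
  drop-++-length []      r = refl
  drop-++-length (x ∷ u) r = drop-++-length u r

  square⇒prefixSquare : ∀ {w : Word} u r → u ≢ [] → w ≡ u ++ u ++ r → PrefixSquare w
  square⇒prefixSquare []      r u≢[] _ = ⊥-elim (u≢[] refl)
  square⇒prefixSquare (x ∷ u) r _ refl = lose (∈-upTo⁺ (s≤s (subst (length u ≤_) (sym (length-++ u)) (ℕ.m≤m+n _ _))))
    (sym (trans (cong (prepend (length (x ∷ u))) (drop-++-length (x ∷ u) ((x ∷ u) ++ r)))
                (cong (_++ (x ∷ u) ++ r) (take-++-length (x ∷ u) r))))

  -- Squarefreeness would make the repeated half empty, and `w` would equal its own shorter suffix.
  prefixSquareOf-not-squarefree : ∀ {w : Word} s → s < length w → PrefixSquareOf w s → ¬ Squarefree w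
  prefixSquareOf-not-squarefree {w} s s<w e sf = ℕ.<-irrefl (sym (cong length w≡q))
    (subst (_< length w) (sym (length-drop (suc s) w)) (ℕ.∸-monoʳ-< (s≤s z≤n) s<w))
    where
    q = drop (suc s) w
    w≡q : w ≡ q
    w≡q = trans e (cong (_++ q) (sf [] (take (suc s) q) (drop (suc s) q)
      (trans e (cong (take (suc s) q ++_) (sym (take++drop≡id (suc s) q))))))

  prefixSquare-not-squarefree : ∀ {w : Word} → PrefixSquare w → ¬ Squarefree w
  prefixSquare-not-squarefree ps with s , s∈ , e ← find ps =
    prefixSquareOf-not-squarefree s (∈-upTo⁻ s∈) e

  cons-squarefree : ∀ {z} {w : Word} → Squarefree w → ¬ PrefixSquare (z ∷ w) → Squarefree (z ∷ w)
  cons-squarefree sf ¬ps []      []      r e = refl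
  cons-squarefree sf ¬ps []      (x ∷ u) r e = ⊥-elim (¬ps (square⇒prefixSquare (x ∷ u) r (λ ()) e))
  cons-squarefree sf ¬ps (_ ∷ l) u       r e = sf l u r (∷-injectiveʳ e)

  squarefree-drop : ∀ n {w : Word} → Squarefree w → Squarefree (drop n w)
  squarefree-drop n {w} sf = squarefree-factor (take n w) []
    (subst Squarefree (sym (trans (cong (take n w ++_) (++-identityʳ _)) (take++drop≡id n w))) sf)

  words-sound : ∀ n {w} → w ∈ words n → Squarefree w × length w ≡ n
  words-sound zero (here refl) = nil , refl
    where
    nil : Squarefree []
    nil [] [] _ _ = refl
    nil [] (_ ∷ _) _ ()
    nil (_ ∷ _) _ _ ()
  words-sound (suc n) w∈ with ∈-filter⁻ (λ w → ¬? (prefixSquare? w)) {xs = extensions n} w∈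
  ... | q , ¬ps with _ , _ , _ , v∈ , refl ← ∈-cartesianProductWith⁻ _∷_ (allFin K) (words n) q
    with sf , l ← words-sound n v∈ = cons-squarefree sf ¬ps , cong suc l

  words-complete : ∀ w → Squarefree w → w ∈ words (length w)
  words-complete []      _  = here refl
  words-complete (x ∷ w) sf = ∈-filter⁺ _
    (∈-cartesianProductWith⁺ _∷_ (∈-allFin x) (words-complete w (squarefree-drop 1 sf)))
    (λ ps → prefixSquare-not-squarefree ps sf)

  # : ℕ → ℕ
  # n = length (words n)

  Σ# : ℕ → ℕ
  Σ# zero    = # 0
  Σ# (suc n) = # (suc n) + Σ# n

  -- A non-squarefree extension z ∷ w of a squarefree w is determined by the half-length of its
  -- square prefix and the squarefree word left after deleting the first half.
  rebuilt : ℕ → ℕ → List Word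
  rebuilt s zero    = map (prepend (suc s)) (words 0)
  rebuilt s (suc n) = map (prepend (suc s)) (words (suc n)) ++ rebuilt (suc s) n

  length-rebuilt : ∀ s n → length (rebuilt s n) ≡ Σ# n
  length-rebuilt s zero    = length-map (prepend (suc s)) (words 0)
  length-rebuilt s (suc n) = trans (length-++ (map (prepend (suc s)) (words (suc n))))
    (cong₂ _+_ (length-map (prepend (suc s)) (words (suc n))) (length-rebuilt (suc s) n))

  ∈-rebuilt : ∀ s n k {q} → k ≤ n → q ∈ words (n ∸ k) → prepend (suc (s + k)) q ∈ rebuilt s n
  ∈-rebuilt s zero zero z≤n q∈ rewrite ℕ.+-identityʳ s = ∈-map⁺ (prepend (suc s)) q∈
  ∈-rebuilt s (suc n) zero z≤n q∈ rewrite ℕ.+-identityʳ s = ∈-++⁺ˡ (∈-map⁺ (prepend (suc s)) q∈)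
  ∈-rebuilt s (suc n) (suc k) (s≤s k≤n) q∈ rewrite ℕ.+-suc s k =
    ∈-++⁺ʳ (map (prepend (suc s)) (words (suc n))) (∈-rebuilt (suc s) n k k≤n q∈)

  #-extend : ∀ n → K * # n ≤ # (suc n) + Σ# n
  #-extend n = begin
    K * # n                                    ≡⟨ cong (_* # n) (length-tabulate {n = K} (λ i → i)) ⟨
    length (allFin K) * # n                    ≡⟨ length-cartesianProductWith _∷_ (allFin K) (words n) ⟨
    length (extensions n)                      ≡⟨ length-filter-¬ prefixSquare? (extensions n) ⟨
    length bad + # (suc n)                     ≡⟨ ℕ.+-comm (length bad) _ ⟩
    # (suc n) + length bad                     ≤⟨ ℕ.+-monoʳ-≤ (# (suc n)) (unique-⊆-length bad-unique bad⊆) ⟩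
    # (suc n) + length (rebuilt 0 n)           ≡⟨ cong (# (suc n) +_) (length-rebuilt 0 n) ⟩
    # (suc n) + Σ# n                           ∎
    where
    open ℕ.≤-Reasoning
    bad = filter prefixSquare? (extensions n)
    bad-unique : Unique bad
    bad-unique = Unique.filter⁺ prefixSquare? (extensions-unique n (words-unique n))
    bad⊆ : ∀ {w} → w ∈ bad → w ∈ rebuilt 0 n
    bad⊆ {w} w∈ with ∈-filter⁻ prefixSquare? {xs = extensions n} w∈
    ... | w∈′ , ps with s , s∈ , e ← find ps
      with z , v , _ , v∈ , refl ← ∈-cartesianProductWith⁻ _∷_ (allFin K) (words n) w∈′
      with sf , refl ← words-sound n v∈ =
      subst (_∈ rebuilt 0 n) (sym e) (∈-rebuilt 0 (length v) s (ℕ.≤-pred (∈-upTo⁻ s∈))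
        (subst (λ m → drop s v ∈ words m) (length-drop s v) (words-complete (drop s v) (squarefree-drop s sf))))

  singleton-squarefree : ∀ x → Squarefree {A = Fin K} (x ∷ [])
  singleton-squarefree x []      []      r e = refl
  singleton-squarefree x []      (_ ∷ []) r e with () ← ∷-injectiveʳ e
  singleton-squarefree x []      (_ ∷ _ ∷ _) r e with () ← ∷-injectiveʳ e
  singleton-squarefree x (_ ∷ []) [] r e = refl
  singleton-squarefree x (_ ∷ []) (_ ∷ _) r e with () ← ∷-injectiveʳ e
  singleton-squarefree x (_ ∷ _ ∷ _) u r e with () ← ∷-injectiveʳ e

  K≤#1 : K ≤ # 1
  K≤#1 = begin
    K                                        ≡⟨ trans (length-map (_∷ []) (allFin K)) (length-tabulate {n = K} (λ i → i)) ⟨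
    length (map (_∷ []) (allFin K))          ≤⟨ unique-⊆-length (Unique.map⁺ ∷-injectiveˡ (Unique.allFin⁺ K)) sub ⟩
    # 1                                      ∎
    where
    open ℕ.≤-Reasoning
    sub : ∀ {w} → w ∈ map (_∷ []) (allFin K) → w ∈ words 1
    sub w∈ with x , _ , refl ← ∈-map⁻ (_∷ []) w∈ = words-complete (x ∷ []) (singleton-squarefree x)

  SameEnds : Word → Set
  SameEnds w = head w ≡ List.last w

  sameEnds? : Decidable SameEnds
  sameEnds? w = Maybe.≡-dec Fin._≟_ (head w) (List.last w)

  openWords : ℕ → List Word
  openWords n = filter (λ w → ¬? (sameEnds? w)) (words n)

  openWords-unique : ∀ n → Unique (openWords n)
  openWords-unique n = Unique.filter⁺ _ (words-unique n)

  openWords-sound : ∀ n {w} → w ∈ openWords n → Squarefree w × length w ≡ n × ¬ SameEnds w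
  openWords-sound n w∈ with w∈′ , ne ← ∈-filter⁻ (λ w → ¬? (sameEnds? w)) {xs = words n} w∈
    with sf , l ← words-sound n w∈′ = sf , l , ne

  -- The first letter of a word with equal ends is redundant.
  #-openWords : ∀ n → # (2 + n) ≤ length (openWords (2 + n)) + # (1 + n)
  #-openWords n = begin
    # (2 + n)                                   ≡⟨ length-filter-¬ sameEnds? (words (2 + n)) ⟨
    length closed + length (openWords (2 + n))  ≡⟨ ℕ.+-comm (length closed) _ ⟩
    length (openWords (2 + n)) + length closed  ≤⟨ ℕ.+-monoʳ-≤ _ (unique-⊆-length (Unique.filter⁺ sameEnds? (words-unique (2 + n))) sub) ⟩
    length (openWords (2 + n)) + length (map close (words (1 + n))) ≡⟨ cong (length (openWords (2 + n)) +_) (length-map close (words (1 + n))) ⟩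
    length (openWords (2 + n)) + # (1 + n)      ∎
    where
    open ℕ.≤-Reasoning
    closed = filter sameEnds? (words (2 + n))
    close : Word → Word
    -- The default is never reached here: `close` is only applied to words of length at least one.
    close w = maybe′ (_∷ w) [] (List.last w)
    sub : ∀ {w} → w ∈ closed → w ∈ map close (words (1 + n))
    sub {w} w∈ with ∈-filter⁻ sameEnds? {xs = words (2 + n)} w∈
    ... | w∈′ , same with words-sound (2 + n) w∈′
    sub {z ∷ y ∷ v} w∈ | w∈′ , same | sf , l =
      subst (_∈ map close (words (1 + n))) (cong (maybe′ (_∷ y ∷ v) []) (sym same))
        (∈-map⁺ close (subst (λ m → y ∷ v ∈ words m) (ℕ.suc-injective l) (words-complete (y ∷ v) (squarefree-drop 1 sf))))

module Growth (M : ℕ) where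
  N K : ℕ
  N = 2 + M
  K = 2 + N
  open Counting K
  open ℕ.≤-Reasoning

  -- The two letters by which `K` exceeds `N` pay for the non-squarefree extensions, of which there
  -- are at most `Σ# n`.
  Σ#≤⇒N*#≤# : ∀ n → Σ# n ≤ 2 * # n → N * # n ≤ # (suc n)
  Σ#≤⇒N*#≤# n q = ℕ.+-cancelʳ-≤ (2 * # n) _ _ (begin
    N * # n + 2 * # n   ≡⟨ ℕ.*-distribʳ-+ (# n) N 2 ⟨
    (N + 2) * # n       ≡⟨ cong (_* # n) (ℕ.+-comm N 2) ⟩
    K * # n             ≤⟨ #-extend n ⟩
    # (suc n) + Σ# n    ≤⟨ ℕ.+-monoʳ-≤ (# (suc n)) q ⟩
    # (suc n) + 2 * # n ∎)
  -- The bounds support each other: growth by a factor `N` of at least 2 keeps the sum of all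
  -- earlier counts below a geometric series, hence below twice the last count, and this bound gives
  -- the next growth step.
  Σ#≤×N*#≤# : ∀ n → Σ# n ≤ 2 * # n × N * # n ≤ # (suc n)
  Σ#≤×N*#≤# zero    = s≤s z≤n , Σ#≤⇒N*#≤# 0 (s≤s z≤n)
  Σ#≤×N*#≤# (suc n) with q , g ← Σ#≤×N*#≤# n = q′ , Σ#≤⇒N*#≤# (suc n) q′
    where
    q′ : Σ# (suc n) ≤ 2 * # (suc n)
    q′ = begin
      # (suc n) + Σ# n             ≤⟨ ℕ.+-monoʳ-≤ (# (suc n)) q ⟩
      # (suc n) + 2 * # n          ≤⟨ ℕ.+-monoʳ-≤ (# (suc n)) (ℕ.*-monoˡ-≤ (# n) (ℕ.m≤m+n 2 M)) ⟩
      # (suc n) + N * # n          ≤⟨ ℕ.+-monoʳ-≤ (# (suc n)) g ⟩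
      # (suc n) + # (suc n)        ≡⟨ cong (# (suc n) +_) (ℕ.+-identityʳ _) ⟨
      2 * # (suc n)                ∎

  N*#≤# : ∀ n → N * # n ≤ # (suc n)
  N*#≤# n = proj₂ (Σ#≤×N*#≤# n)

  -- The first letter has `K` choices instead of `N`. This surplus is what later pays for discarding
  -- the words with equal ends.
  K*N^n≤# : ∀ n → K * N ^ n ≤ # (suc n)
  K*N^n≤# zero    = subst (_≤ # 1) (sym (ℕ.*-identityʳ K)) K≤#1
  K*N^n≤# (suc n) = begin
    K * (N * N ^ n)   ≡⟨ x∙yz≈y∙xz ℕ.*-commutativeSemigroup K N (N ^ n) ⟩
    N * (K * N ^ n)   ≤⟨ ℕ.*-monoʳ-≤ N (K*N^n≤# n) ⟩
    N * # (suc n)     ≤⟨ N*#≤# (suc n) ⟩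
    # (suc (suc n))   ∎

  -- (N − 1)(N + 2) ≥ N².
  N^n≤#openWords : ∀ n → N ^ (2 + n) ≤ length (openWords (2 + n))
  N^n≤#openWords n = begin
    N * (N * N ^ n)             ≡⟨ ℕ.*-assoc N N (N ^ n) ⟨
    N * N * N ^ n               ≤⟨ ℕ.*-monoˡ-≤ (N ^ n) N*N≤ ⟩
    suc M * K * N ^ n           ≡⟨ ℕ.*-assoc (suc M) K (N ^ n) ⟩
    suc M * (K * N ^ n)         ≤⟨ ℕ.*-monoʳ-≤ (suc M) (K*N^n≤# n) ⟩
    suc M * # (suc n)           ≤⟨ ℕ.+-cancelˡ-≤ (# (suc n)) _ _ (begin
      N * # (suc n)                                ≤⟨ N*#≤# (suc n) ⟩
      # (2 + n)                                    ≤⟨ #-openWords n ⟩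
      length (openWords (2 + n)) + # (suc n)       ≡⟨ ℕ.+-comm _ (# (suc n)) ⟩
      # (suc n) + length (openWords (2 + n))       ∎) ⟩
    length (openWords (2 + n))  ∎
    where
    open +-*-Solver using (solve; con; _:+_; _:*_; _:=_)
    N*N≤ : N * N ≤ suc M * K
    N*N≤ = begin
      (2 + M) * (2 + M)          ≤⟨ ℕ.m≤m+n _ M ⟩
      (2 + M) * (2 + M) + M      ≡⟨ solve 1 (λ m → (con 2 :+ m) :* (con 2 :+ m) :+ m := (con 1 :+ m) :* (con 4 :+ m)) refl M ⟩
      (1 + M) * (4 + M)          ∎

-- Building codes from squarefree words

unique-lookup-injective : ∀ {A : Set} {xs : List A} → Unique xs → ∀ {i j} → lookup xs i ≡ lookup xs j → i ≡ j
unique-lookup-injective (_ ∷ _)  {zero}  {zero}  _ = refl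
unique-lookup-injective (x∉ ∷ _) {zero}  {suc j} e = ⊥-elim (All.lookup x∉ (∈-lookup j) e)
unique-lookup-injective (x∉ ∷ _) {suc i} {zero}  e = ⊥-elim (All.lookup x∉ (∈-lookup i) (sym e))
unique-lookup-injective (_ ∷ u)  {suc i} {suc j} e = cong suc (unique-lookup-injective u e)

last-snoc : ∀ {A : Set} (l : List A) {x} → List.last (l ∷ʳ x) ≡ just x
last-snoc []          = refl
last-snoc (_ ∷ [])    = refl
last-snoc (_ ∷ y ∷ l) = last-snoc (y ∷ l)

transpose-left : ∀ {n} (i j : Fin n) → transpose i j i ≡ j
transpose-left i j rewrite dec-true (i Fin.≟ i) refl = refl

transpose-other : ∀ {n} (i j : Fin n) {k} → k ≢ i → k ≢ j → transpose i j k ≡ k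
transpose-other i j {k} k≢i k≢j rewrite dec-false (k Fin.≟ i) k≢i | dec-false (k Fin.≟ j) k≢j = refl

transpose-injective : ∀ {n} (i j : Fin n) {k l} → transpose i j k ≡ transpose i j l → k ≡ l
transpose-injective i j e = trans (sym (transpose-inverse j i)) (trans (cong (transpose j i) e) (transpose-inverse j i))

module _ {K : ℕ} where
  open Counting K using (Word; SameEnds)

  first-last : ∀ {w} → ¬ SameEnds w → ∃₂ λ a b → (∃ λ l → w ≡ a ∷ l) × (∃ λ l → w ≡ l ∷ʳ b) × a ≢ b
  first-last {w} ne with initLast w
  ... | []            = ⊥-elim (ne refl)
  ... | [] ∷ʳ′ b      = ⊥-elim (ne refl)
  ... | (a ∷ l) ∷ʳ′ b = a , b , (l ∷ʳ b , refl) , (a ∷ l , refl) ,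
        λ a≡b → ne (trans (cong just a≡b) (sym (last-snoc (a ∷ l))))

module Bridge {K : ℕ} (w : List (Fin K)) (sf : Squarefree w) {a b : Fin K}
              (start : ∃ λ l → w ≡ a ∷ l) (finish : ∃ λ l → w ≡ l ∷ʳ b) (a≢b : a ≢ b) where

  -- A permutation of the letters taking a to f and b to g.
  relabel : Fin K → Fin K → Fin K → Fin K
  relabel f g x = transpose (transpose a f b) g (transpose a f x)

  relabel-injective : ∀ f g {x y} → relabel f g x ≡ relabel f g y → x ≡ y
  relabel-injective f g e = transpose-injective a f (transpose-injective (transpose a f b) g e)

  relabel-a : ∀ {f g} → f ≢ g → relabel f g a ≡ f
  relabel-a {f} {g} f≢g rewrite transpose-left a f =
    transpose-other (transpose a f b) g
      (λ e → a≢b (transpose-injective a f (trans (transpose-left a f) e))) f≢g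

  relabel-b : ∀ f g → relabel f g b ≡ g
  relabel-b f g = transpose-left (transpose a f b) g

  -- Relabelling independently for both orders of `f` and `g` would not give mutually reversed
  -- words. So only the increasing order is relabelled, and the other is defined as its reversal.
  bridge : Fin K → Fin K → List (Fin K)
  bridge f g with f Fin.<? g
  ... | yes _ = map (relabel f g) w
  ... | no _  = reverse (map (relabel g f) w)

  bridge-length : ∀ f g → length (bridge f g) ≡ length w
  bridge-length f g with f Fin.<? g
  ... | yes _ = length-map (relabel f g) w
  ... | no _  = trans (length-reverse (map (relabel g f) w)) (length-map (relabel g f) w)

  bridge-squarefree : ∀ f g → Squarefree (bridge f g)
  bridge-squarefree f g with f Fin.<? g
  ... | yes _ = squarefree-map (relabel f g) (relabel-injective f g) sf
  ... | no _  = squarefree-reverse (squarefree-map (relabel g f) (relabel-injective g f) sf)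

  bridge-head : ∀ {f g} → f ≢ g → ∃ λ l → bridge f g ≡ f ∷ l
  bridge-head {f} {g} f≢g with f Fin.<? g
  ... | yes _ = map (relabel f g) (proj₁ start) ,
        trans (cong (map (relabel f g)) (proj₂ start)) (cong (_∷ map (relabel f g) (proj₁ start)) (relabel-a f≢g))
  ... | no _ = reverse (map (relabel g f) l) , (begin
        reverse (map (relabel g f) w)                        ≡⟨ cong (λ w → reverse (map (relabel g f) w)) (proj₂ finish) ⟩
        reverse (map (relabel g f) (l ∷ʳ b))                 ≡⟨ cong reverse (map-++ (relabel g f) l _) ⟩
        reverse (map (relabel g f) l ∷ʳ relabel g f b)       ≡⟨ reverse-snoc (map (relabel g f) l) _ ⟩
        relabel g f b ∷ reverse (map (relabel g f) l)        ≡⟨ cong (_∷ reverse (map (relabel g f) l)) (relabel-b g f) ⟩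
        f ∷ reverse (map (relabel g f) l)                    ∎)
    where
    open ≡-Reasoning
    l = proj₁ finish

  bridge-reverse : ∀ {f g} → f ≢ g → bridge f g ≡ reverse (bridge g f)
  bridge-reverse {f} {g} f≢g with f Fin.<? g | g Fin.<? f
  ... | yes f<g | yes g<f = ⊥-elim (Fin.<-asym f<g g<f)
  ... | yes _   | no _    = sym (reverse-involutive _)
  ... | no _    | yes _   = refl
  ... | no f≮g  | no g≮f with Fin.<-cmp f g
  ...   | tri< q _ _ = ⊥-elim (f≮g q)
  ...   | tri≈ _ q _ = ⊥-elim (f≢g q)
  ...   | tri> _ _ q = ⊥-elim (g≮f q)

module Codes (M : ℕ) where
  open Growth M
  open Counting K

  abstract
    openWord : ∀ n → Fin (N ^ (2 + n)) → Word
    openWord n i = lookup (openWords (2 + n)) (inject≤ i (N^n≤#openWords n))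

    openWord-sound : ∀ n i → Squarefree (openWord n i) × length (openWord n i) ≡ 2 + n × ¬ SameEnds (openWord n i)
    openWord-sound n i = openWords-sound (2 + n) (∈-lookup _)

    openWord-injective : ∀ n {i j} → openWord n i ≡ openWord n j → i ≡ j
    openWord-injective n e = Fin.inject≤-injective _ _ _ _ (unique-lookup-injective (openWords-unique (2 + n)) e)

  some : ∀ n → Fin (N ^ n)
  some n = fromℕ< (ℕ.m^n>0 N n)

  -- Serves codes with words of length `suc t`. A single long word with distinct ends suffices,
  -- since its relabellings supply all the twin words; `openWord` counts from length two, hence its
  -- index `t + suc t` for length 2 (t + 1) + 1.
  private module Long (t : ℕ) where
    private
      long = openWord (t + suc t) (some (2 + (t + suc t)))
      sound = openWord-sound (t + suc t) (some (2 + (t + suc t)))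
      ends = first-last (proj₂ (proj₂ sound))
    open Bridge long (proj₁ sound) (proj₁ (proj₂ (proj₂ ends))) (proj₁ (proj₂ (proj₂ (proj₂ ends))))
                (proj₂ (proj₂ (proj₂ (proj₂ ends)))) public
    long-length : length long ≡ suc (suc t + suc t)
    long-length = proj₁ (proj₂ sound)

  code₁ : ∀ {p} → p ≤ N → Code p K 1
  code₁ {p} p≤N = record
    { h             = λ x → letter x ∷ []
    ; hd            = letter
    ; h-head        = λ x → [] , refl
    ; h-length      = λ _ → refl
    ; h-squarefree  = λ x → singleton-squarefree (letter x)
    ; h-injective   = λ e → letter-injective (∷-injectiveˡ e)
    ; Twin          = _≢_
    ; twin?         = λ x y → ¬? (x Fin.≟ y)
    ; twin-sym      = λ n e → n (sym e)
    ; twin-heads    = λ n e → n (letter-injective e)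
    ; twin-code     = inj₁ letter-injective
    ; non-twin-ends = λ n ¬n → ⊥-elim (¬n n)
    ; non-twin-code = λ n ¬n → ⊥-elim (¬n n)
    ; v             = λ x y → bridge (letter x) (letter y)
    ; v-head        = λ n → bridge-head (λ e → n (letter-injective e))
    ; v-reverse     = λ n → bridge-reverse (λ e → n (letter-injective e))
    ; v-length      = λ {x} {y} _ → trans (bridge-length (letter x) (letter y)) long-length
    ; v-squarefree  = λ {x} {y} _ → bridge-squarefree (letter x) (letter y)
    }
    where
    open Long 0
    p≤K : p ≤ K
    p≤K = ℕ.≤-trans p≤N (ℕ.m≤n+m N 2)
    letter : Fin p → Fin K
    letter x = inject≤ x p≤K
    letter-injective : ∀ {x y} → letter x ≡ letter y → x ≡ y
    letter-injective = Fin.inject≤-injective _ _ _ _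

  code₂ : ∀ n {p} → p ≤ N ^ (2 + n) → Code p K (2 + n)
  code₂ n {p} p≤ = record
    { h             = h
    ; hd            = hd
    ; h-head        = h-head
    ; h-length      = λ x → proj₁ (proj₂ (sound x))
    ; h-squarefree  = λ x → proj₁ (sound x)
    ; h-injective   = λ e → Fin.inject≤-injective _ _ _ _ (openWord-injective n e)
    ; Twin          = λ x y → h x ≡ reverse (h y)
    ; twin?         = λ x y → ≡-dec Fin._≟_ (h x) (reverse (h y))
    ; twin-sym      = λ e → sym (trans (cong reverse e) (reverse-involutive _))
    ; twin-heads    = twin-heads
    ; twin-code     = inj₂ (λ e → e)
    ; non-twin-ends = λ {x} _ _ l → open-ends x l
    ; non-twin-code = λ _ n → n
    ; v             = λ x y → bridge (hd x) (hd y)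
    ; v-head        = λ s → bridge-head (twin-heads s)
    ; v-reverse     = λ s → bridge-reverse (twin-heads s)
    ; v-length      = λ {x} {y} _ → trans (bridge-length (hd x) (hd y)) long-length
    ; v-squarefree  = λ {x} {y} _ → bridge-squarefree (hd x) (hd y)
    }
    where
    open Long (suc n)
    h : Fin p → Word
    h x = openWord n (inject≤ x p≤)
    sound : ∀ x → Squarefree (h x) × length (h x) ≡ 2 + n × ¬ SameEnds (h x)
    sound x = openWord-sound n (inject≤ x p≤)
    ends : ∀ x → _
    ends x = first-last (proj₂ (proj₂ (sound x)))
    hd : Fin p → Fin K
    hd x = proj₁ (ends x)
    h-head : ∀ x → ∃ λ l → h x ≡ hd x ∷ l
    h-head x = proj₁ (proj₂ (proj₂ (ends x)))
    open-ends : ∀ x l → h x ≢ l ∷ʳ hd x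
    open-ends x l e = proj₂ (proj₂ (sound x))
      (trans (cong head (proj₂ (h-head x))) (sym (trans (cong List.last e) (last-snoc l))))
    twin-heads : ∀ {x y} → h x ≡ reverse (h y) → hd x ≢ hd y
    twin-heads {x} {y} e e′ with l , q ← h-head y = open-ends x (reverse l)
      (trans e (trans (cong reverse q) (trans (unfold-reverse (hd y) l) (cong (reverse l ∷ʳ_) (sym e′)))))

  code : ∀ t {p} → 1 ≤ t → p ≤ N ^ t → Code p K t
  code 1 {p}         _ p≤ = code₁ (subst (p ≤_) (ℕ.*-identityʳ N) p≤)
  code (suc (suc n)) _ p≤ = code₂ n p≤

-- From codes to the bound

π-subdivision≤ : ∀ M (G : Graph) t p q → 1 ≤ t → p ≤ (2 + M) ^ t → IsPi (toAdj G) p →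
                 IsPi (subdivision G (suc (t + t))) q → q ≤ 5 + M
π-subdivision≤ M G t p q 1≤t p≤ ((φ , nr) , _) (_ , minimal) = minimal (5 + M) colour nonrepetitive
  where open Colouring G t (suc (t + t)) refl (Codes.code M t 1≤t p≤) φ nr

π-subdivision≡0 : ∀ (G : Graph) d q → IsPi (toAdj G) 0 → IsPi (subdivision G d) q → q ≡ 0
π-subdivision≡0 G d q ((φ , _) , _) (_ , minimal) = ℕ.n≤0⇒n≡0 (minimal 0 ψ nonrepetitive)
  where
  ψ : V (subdivision G d) → Fin 0
  ψ (inj₁ u)       = φ u
  ψ (inj₂ (i , _)) = φ (proj₁ (lookup (Graph.edges G) i))
  nonrepetitive : Nonrepetitive (subdivision G d) 0 ψ
  nonrepetitive _ _ ([] , _ , _ , () , _)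
  nonrepetitive _ _ (y ∷ _ , _) with () ← ψ y

theorem93 : (G : Graph) (d : ℕ) → (∃[ t ] d ≡ suc (2 * t)) → 3 ≤ d →
    (p q : ℕ) → IsPi (toAdj G) p → IsPi (subdivision G d) q →
    (q ∸ 4) ^ ((d ∸ 1) / 2) ≤ p
theorem93 G _ (zero , refl) (s≤s ())
theorem93 G d (t@(suc _) , refl) _ p q πG πH
  rewrite trans (cong (_/ 2) (ℕ.*-comm 2 t)) (m*n/n≡m t 2) = go q refl
  where
  go : ∀ r → q ≡ r → (r ∸ 4) ^ t ≤ p
  go 0 _ = z≤n
  go 1 _ = z≤n
  go 2 _ = z≤n
  go 3 _ = z≤n
  go 4 _ = z≤n
  -- Here N is 1, too small for the counting; the claim is only that `p` is positive, and a graph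
  -- without vertices has a subdivision that needs no colour.
  go 5 q≡5 = subst (_≤ p) (sym (ℕ.^-zeroˡ t)) (ℕ.n≢0⇒n>0 p≢0)
    where
    p≢0 : p ≢ 0
    p≢0 refl with () ← trans (sym q≡5) (π-subdivision≡0 G d q πG πH)
  -- With q = 6 + M the number N = q - 4 is 2 + M. If the claim failed, 0 together with the 4 + M
  -- letters would give a colouring with 5 + M = q - 1 colours.
  go (suc (suc (suc (suc (suc (suc M)))))) q≡ with (2 + M) ^ t ℕ.≤? p
  ... | yes ≤p = ≤p
  ... | no  ≰p = ⊥-elim (ℕ.<-irrefl refl (subst (_≤ 5 + M) q≡
        (π-subdivision≤ M G t p q (s≤s z≤n) (ℕ.<⇒≤ (ℕ.≰⇒> ≰p)) πG
          (subst (λ d → IsPi (subdivision G (suc d)) q) (cong (t +_) (ℕ.+-identityʳ t)) πH))))
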